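{- The series $\widetilde H_{a_1,\dots,a_r}(z)$ and $\Psi(z)\widetilde H_{a_1,\dots,a_r}(z)$, where $r\ge1$ and $(a_1,\dots,a_r)$ ranges over (pairwise distinct) tuples of positive integers none of which is divisible by $3$, together with the series $1$, are linearly independent over $(\mathbb Z/3\mathbb Z)[z]$, and consequently also over $(\mathbb Z/3^\gamma\mathbb Z)[z]$ for every positive integer $\gamma$, and over $\mathbb Z[z]$.
   Context: $\Psi(z)=\prod_{j\ge0}\bigl(1+z^{3^j}\bigr)$. For positive integers $a_1,\dots,a_r$, $$\widetilde H_{a_1,\dots,a_r}(z)=\sum_{k_1>\dots>k_r\ge0}\prod_{j=1}^{r}\left(\frac{z^{3^{k_j}}(1+z^{3^{k_j}})}{1+z^{3^{k_j+1}}}\right)^{a_j},$$ a formal power series in $z$ with integer coefficients (rational functions expanded as power series in $z$); $\widetilde H_{\emptyset}=1$. -}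

module Defs where

open import Level using (0ℓ)
open import Algebra.Properties.Semiring.Sum using (sum-syntax; sum⁺-syntax)
open import Data.Bool.Base using (if_then_else_)
open import Data.Fin.Base as Fin using (Fin; toℕ)
open import Data.Integer.Base using (ℤ; +_; 0ℤ; 1ℤ; _+_; _*_; _-_)
open import Data.Integer.Divisibility.Signed using () renaming (_∣_ to _∣ℤ_)
import Data.Integer.Properties as ℤₚ
open import Data.Integer.Tactic.RingSolver using (solve-∀)
open import Data.List.Base using (List; []; _∷_; _++_; map; foldr; length)
open import Data.List.Relation.Unary.All using (All; []; _∷_)
open import Data.Nat.Base as ℕ using (ℕ; zero; suc; _^_; _∸_; _≤_; _<_; z≤n; s≤s)
open import Data.Nat.Divisibility using (_∤_)
import Data.Nat.Properties as ℕₚ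
open import Data.Product.Base using (_×_; _,_; ∃-syntax)
open import Data.Sum.Base using (inj₁; inj₂)
open import Data.Unit.Base using (⊤)
open import Data.Vec.Base as Vec using (Vec; []; _∷_)
open import Function.Base using (_∘_)
open import Function.Definitions using (Injective)
open import Relation.Binary.Core using (Rel)
open import Relation.Binary.PropositionalEquality
open import Relation.Nullary.Decidable using (dec-false)
open import Relation.Unary using (Pred)

∑< : (n : ℕ) → (Fin n → ℤ) → ℤ
∑< = sum-syntax ℤₚ.+-*-semiring

∑≤ : (n : ℕ) → (Fin (suc n) → ℤ) → ℤ
∑≤ = sum⁺-syntax ℤₚ.+-*-semiring

Series : Set
Series = ℕ → ℤ

infixl 6 _⊕_
infixl 7 _⊛_ _⊘_
infixr 8 _^ˢ_

0ˢ : Series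
0ˢ _ = 0ℤ

z^_ : ℕ → Series
(z^ k) n = if n ℕ.≡ᵇ k then 1ℤ else 0ℤ

1ˢ : Series
1ˢ = z^ 0

_⊕_ : Series → Series → Series
(f ⊕ g) n = f n + g n

_⊛_ : Series → Series → Series
(f ⊛ g) n = ∑≤ n λ i → f (toℕ i) * g (n ∸ toℕ i)

_^ˢ_ : Series → ℕ → Series
f ^ˢ zero  = 1ˢ
f ^ˢ suc a = f ⊛ f ^ˢ a

-- Long division, meaningful only when g has constant term 1 (see ⊘-⊛):
-- f / g = f₀ + z · ((f − f₀ g) / z) / g.
_⊘_ : Series → Series → Series
(f ⊘ g) zero    = f 0
(f ⊘ g) (suc n) = ((λ i → f (suc i) - f 0 * g (suc i)) ⊘ g) n

⊘-⊛ : ∀ f g → g 0 ≡ 1ℤ → ∀ n → ((f ⊘ g) ⊛ g) n ≡ f n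
⊘-⊛ f g g₀ zero = begin
  f 0 * g 0 + 0ℤ ≡⟨ cong (λ c → f 0 * c + 0ℤ) g₀ ⟩
  f 0 * 1ℤ + 0ℤ  ≡⟨ ℤₚ.+-identityʳ _ ⟩
  f 0 * 1ℤ       ≡⟨ ℤₚ.*-identityʳ _ ⟩
  f 0            ∎
  where open ≡-Reasoning
⊘-⊛ f g g₀ (suc n) =
  trans (cong (λ c → f 0 * g (suc n) + c) (⊘-⊛ (λ i → f (suc i) - f 0 * g (suc i)) g g₀ n))
    (lem (f 0 * g (suc n)) (f (suc n)))
  where
  lem : ∀ x y → x + (y - x) ≡ y
  lem = solve-∀

_⟶_ : (ℕ → Series) → Series → Set
s ⟶ f = ∀ n → ∃[ N ] (∀ M → N ≤ M → s M n ≡ f n)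

Ψ-partial : ℕ → Series
Ψ-partial zero    = 1ˢ
Ψ-partial (suc N) = Ψ-partial N ⊛ (1ˢ ⊕ z^ (3 ^ N))

-- The coefficient of zⁿ no longer changes after the factors with j ≤ n
-- (see Ψ-limit).
Ψ : Series
Ψ n = Ψ-partial (suc n) n

summand : ℕ → Series
summand k = (z^ (3 ^ k) ⊛ (1ˢ ⊕ z^ (3 ^ k))) ⊘ (1ˢ ⊕ z^ (3 ^ suc k))

-- All (k₁, …, kᵣ) with K > k₁ > ⋯ > kᵣ ≥ 0, each listed once.
chains : (r K : ℕ) → List (Vec ℕ r)
chains zero    K       = [] ∷ []
chains (suc r) zero    = []
chains (suc r) (suc K) = chains (suc r) K ++ map (K ∷_) (chains r K)

term : (a : List ℕ) → Vec ℕ (length a) → Series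
term []       []       = 1ˢ
term (a ∷ as) (k ∷ ks) = summand k ^ˢ a ⊛ term as ks

sumOver : {A : Set} → (A → Series) → List A → Series
sumOver f = foldr (λ x s → f x ⊕ s) 0ˢ

H̃-partial : List ℕ → ℕ → Series
H̃-partial a K = sumOver (term a) (chains (length a) K)

-- For positive exponents the coefficient of zⁿ no longer changes after the
-- chains with k₁ ≤ n (see H̃-limit); other exponents are not meaningful.
H̃ : List ℕ → Series
H̃ a n = H̃-partial a (suc n) n

n<3^n : ∀ n → n < 3 ^ n
n<3^n zero    = s≤s z≤n
n<3^n (suc n) = ℕₚ.≤-trans (s≤s (n<3^n n))
  (ℕₚ.≤-trans (ℕₚ.+-monoˡ-≤ (3 ^ n) (ℕₚ.m^n>0 3 n))
              (ℕₚ.+-monoʳ-≤ (3 ^ n) (ℕₚ.m≤m+n (3 ^ n) _)))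

z^-off : ∀ {n k} → n < k → (z^ k) n ≡ 0ℤ
z^-off {n} {k} n<k = cong (λ b → if b then 1ℤ else 0ℤ)
  (dec-false (n ℕₚ.≟ k) (ℕₚ.<⇒≢ n<k))

∑-zero : ∀ {n} (f : Fin n → ℤ) → (∀ i → f i ≡ 0ℤ) → ∑< n f ≡ 0ℤ
∑-zero {zero}  f f≡0 = refl
∑-zero {suc n} f f≡0 = cong₂ _+_ (f≡0 Fin.zero) (∑-zero (f ∘ Fin.suc) (f≡0 ∘ Fin.suc))

∑-cong : ∀ {n} (f g : Fin n → ℤ) → (∀ i → f i ≡ g i) → ∑< n f ≡ ∑< n g
∑-cong {zero}  f g f≡g = refl
∑-cong {suc n} f g f≡g =
  cong₂ _+_ (f≡g Fin.zero) (∑-cong (f ∘ Fin.suc) (g ∘ Fin.suc) (f≡g ∘ Fin.suc))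

toℕ≤ : ∀ {n} (i : Fin (suc n)) → toℕ i ≤ n
toℕ≤ Fin.zero            = z≤n
toℕ≤ {suc n} (Fin.suc i) = s≤s (toℕ≤ i)

Below : ℕ → Series → Set
Below d f = ∀ n → n < d → f n ≡ 0ℤ

⊛-below : ∀ {d} f g → Below d f → Below d (f ⊛ g)
⊛-below f g f≡0 n n<d = ∑-zero {suc n} (λ i → f (toℕ i) * g (n ∸ toℕ i))
  λ i → cong (_* g (n ∸ toℕ i)) (f≡0 (toℕ i) (ℕₚ.≤-<-trans (toℕ≤ i) n<d))

⊘-below : ∀ n f g → Below (suc n) f → (f ⊘ g) n ≡ 0ℤ
⊘-below zero    f g f≡0 = f≡0 0 (s≤s z≤n)
⊘-below (suc n) f g f≡0 = ⊘-below n _ g λ i i<1+n →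
  cong₂ (λ x y → x - y * g (suc i)) (f≡0 (suc i) (s≤s i<1+n)) (f≡0 0 (s≤s z≤n))

summand-below : ∀ k → Below (3 ^ k) (summand k)
summand-below k n n<d = ⊘-below n (z^ (3 ^ k) ⊛ (1ˢ ⊕ z^ (3 ^ k))) (1ˢ ⊕ z^ (3 ^ suc k))
  λ i i≤n → ⊛-below (z^ (3 ^ k)) (1ˢ ⊕ z^ (3 ^ k)) (λ _ → z^-off) i (ℕₚ.<-≤-trans i≤n n<d)

sumOver-++ : {A : Set} (f : A → Series) (xs ys : List A) (n : ℕ) →
             sumOver f (xs ++ ys) n ≡ sumOver f xs n + sumOver f ys n
sumOver-++ f []       ys n = sym (ℤₚ.+-identityˡ _)
sumOver-++ f (x ∷ xs) ys n =
  trans (cong (λ c → f x n + c) (sumOver-++ f xs ys n)) (sym (ℤₚ.+-assoc (f x n) _ _))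

head-below : ∀ a as K (kss : List (Vec ℕ (length as))) → 0 < a →
             Below (3 ^ K) (sumOver (term (a ∷ as)) (map (K ∷_) kss))
head-below a       as K []         a>0 n n<d = refl
head-below (suc a) as K (ks ∷ kss) a>0 n n<d = cong₂ _+_
  (⊛-below (summand K ^ˢ suc a) (term as ks)
    (⊛-below (summand K) (summand K ^ˢ a) (summand-below K)) n n<d)
  (head-below (suc a) as K kss a>0 n n<d)

H̃-stable : ∀ {a} → All (0 <_) a → ∀ {n} K → n < K → H̃-partial a (suc K) n ≡ H̃-partial a K n
H̃-stable []                           K n<K = refl
H̃-stable {a ∷ as} (a>0 ∷ _) {n} K n<K = begin
  sumOver t (cs ++ ds) n          ≡⟨ sumOver-++ t cs ds n ⟩
  sumOver t cs n + sumOver t ds n ≡⟨ cong (λ c → sumOver t cs n + c) tail≡0 ⟩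
  sumOver t cs n + 0ℤ             ≡⟨ ℤₚ.+-identityʳ _ ⟩
  sumOver t cs n                  ∎
  where
  open ≡-Reasoning
  t  = term (a ∷ as)
  cs = chains (suc (length as)) K
  ds = map (K ∷_) (chains (length as) K)
  tail≡0 : sumOver t ds n ≡ 0ℤ
  tail≡0 = head-below a as K (chains (length as) K) a>0 n (ℕₚ.<-trans n<K (n<3^n K))

⊛-1ˢ : ∀ f n → (f ⊛ 1ˢ) n ≡ f n
⊛-1ˢ f zero    = trans (ℤₚ.+-identityʳ _) (ℤₚ.*-identityʳ (f 0))
⊛-1ˢ f (suc n) = trans (cong₂ _+_ (ℤₚ.*-zeroʳ (f 0)) (⊛-1ˢ (f ∘ suc) n)) (ℤₚ.+-identityˡ _)

Ψ-stable : ∀ {n} N → n < N → Ψ-partial (suc N) n ≡ Ψ-partial N n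
Ψ-stable {n} N n<N = trans
  (∑-cong {suc n} _ (λ i → Ψ-partial N (toℕ i) * 1ˢ (n ∸ toℕ i)) λ i → cong (Ψ-partial N (toℕ i) *_)
    (trans (cong (λ c → 1ˢ (n ∸ toℕ i) + c) (z^-off (ℕₚ.≤-<-trans (ℕₚ.m∸n≤m n (toℕ i))
                                               (ℕₚ.<-trans n<N (n<3^n N)))))
           (ℤₚ.+-identityʳ (1ˢ (n ∸ toℕ i)))))
  (⊛-1ˢ (Ψ-partial N) n)

stable⇒limit : (s : ℕ → Series) → (∀ {n} K → n < K → s (suc K) n ≡ s K n) →
               s ⟶ (λ n → s (suc n) n)
stable⇒limit s stable n = suc n , go
  where
  go : ∀ M → n < M → s M n ≡ s (suc n) n
  go (suc M) (s≤s n≤M) with ℕₚ.m≤n⇒m<n∨m≡n n≤M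
  ... | inj₁ n<M  = trans (stable M n<M) (go M n<M)
  ... | inj₂ refl = refl

Ψ-limit : Ψ-partial ⟶ Ψ
Ψ-limit = stable⇒limit Ψ-partial Ψ-stable

H̃-limit : ∀ {a} → All (0 <_) a → H̃-partial a ⟶ H̃ a
H̃-limit {a} a>0 = stable⇒limit (H̃-partial a) (H̃-stable a>0)

-- The ring ℤ/mℤ is the setoid of integers under this relation.
_≡_[mod_] : ℤ → ℤ → ℕ → Set
x ≡ y [mod m ] = + m ∣ℤ (x - y)

-- Coefficients, constant term first.
Poly : Set
Poly = List ℤ

coeff : Poly → Series
coeff []      n       = 0ℤ
coeff (c ∷ p) zero    = c
coeff (c ∷ p) (suc n) = coeff p n

-- Let R be the quotient of ℤ by a ring congruence ≈. The images in R[[z]] of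
-- the series v i, for i satisfying P, are linearly independent over R[z]:
-- polynomials and series over R are represented by integer coefficients
-- compared with ≈.
LinearlyIndependentOn : {I : Set} → Rel ℤ 0ℓ → Pred I 0ℓ → (I → Series) → Set
LinearlyIndependentOn {I} _≈_ P v =
  ∀ n (ι : Fin n → I) → Injective _≡_ _≡_ ι → (∀ j → P (ι j)) →
  (p : Fin n → Poly) →
  (∀ N → ∑< n (λ j → (coeff (p j) ⊛ v (ι j)) N) ≈ 0ℤ) →
  ∀ j N → coeff (p j) N ≈ 0ℤ

data Label : Set where
  one  : Label
  H̃[_] ΨH̃[_] : List ℕ → Label

series : Label → Series
series one      = 1ˢ
series H̃[ a ]  = H̃ a
series ΨH̃[ a ] = Ψ ⊛ H̃ a

AdmissibleTuple : Pred (List ℕ) 0ℓ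
AdmissibleTuple a = 1 ≤ length a × All (λ aⱼ → 0 < aⱼ × 3 ∤ aⱼ) a

Admissible : Pred Label 0ℓ
Admissible one      = ⊤
Admissible H̃[ a ]  = AdmissibleTuple a
Admissible ΨH̃[ a ] = AdmissibleTuple a

{-# OPTIONS --safe #-}

-- Modulo 3, Frobenius gives Ψ² = 1 / (1 + z) and turns the k-th summand into x ^ (3 ^ k), where
-- x = z / (1 + z)² = Ψ² − Ψ⁴ has degree 4 in Ψ. Splitting off the innermost index, h = H̃[a₁ … aᵣ]
-- satisfies the Artin–Schreier equation h = h³ + x ^ aᵣ h′³ with h′ = H̃[a₁ … aᵣ₋₁]. It suffices
-- that these h are linearly independent over K = 𝔽₃(Ψ), a quadratic extension of 𝔽₃(z).
--
-- Add the h one at a time by increasing length. Suppose the new one, h_m, is a K-combination of the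
-- previous ones. Cube this relation and subtract it from the original one, in which each h is
-- replaced by h³ + x ^ aᵣ h′³: h_m³ cancels, and what remains is a relation between the previous
-- cubes, hence trivial. So a coefficient c at a tuple of the same length as m has c³ = c and is
-- constant, and at the tuple m truncated by its last entry one finds c³ − c = Σₑ cₑ x ^ e with
-- constants cₑ that are not all 0. Since 3 ∤ e, the right-hand side has degree in Ψ prime to 3,
-- and no c ∈ K satisfies this. (Below, the coefficient g of h_m is kept instead of dividing by it.)

module Submission where

open import Defs
open import Level using (0ℓ)
open import Algebra.Bundles using (CommutativeRing; RawRing)
import Algebra.Properties.Semiring.Exp
import Algebra.Solver.Ring
open import Algebra.Solver.Ring.AlmostCommutativeRing using (fromCommutativeRing; _-Raw-AlmostCommutative⟶_)
open import Data.Bool.Base using (Bool; true; false)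
import Data.Bool.Properties as Boolₚ
open import Data.Empty using (⊥; ⊥-elim)
open import Data.Fin.Base as Fin using (Fin)
import Data.Fin.Properties as Finₚ
open import Data.Integer.Base as ℤ using (ℤ; +_; 0ℤ; 1ℤ)
open import Data.Integer.DivMod using (n%ℕd<d; a≡a%n+[a/n]*n)
open import Data.Integer.Divisibility.Signed
  using (∣m∣n⇒∣m+n; ∣m⇒∣-m; ∣n⇒∣m*n; ∣m⇒∣m*n; ∣⇒∣ᵤ; *-cancelˡ-∣; *-monoʳ-∣; ∣-trans)
  renaming (_∣_ to _∣ℤ_; _∣?_ to _∣ℤ?_; divides to dividesℤ)
import Data.Integer.Properties as ℤₚ
open import Data.Integer.Tactic.RingSolver using (solve-∀)
open import Data.List.Base as List
  using (List; []; _∷_; _++_; length; reverse; tabulate; concat; filter; cartesianProductWith)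
open import Data.List.Membership.DecPropositional using () renaming (_∈?_ to member?)
open import Data.List.Membership.Propositional using (_∈_)
open import Data.List.Membership.Propositional.Properties
  using (∈-++⁺ˡ; ∈-++⁺ʳ; ∈-concat⁺′; ∈-filter⁺; ∈-filter⁻; ∈-cartesianProductWith⁺; ∈-cartesianProductWith⁻)
import Data.List.Properties as Listₚ
open import Data.List.Relation.Binary.Permutation.Propositional using (↭-sym)
open import Data.List.Relation.Binary.Permutation.Propositional.Properties using (All-resp-↭; ↭-reverse)
open import Data.List.Relation.Unary.All as All using (All; []; _∷_)
import Data.List.Relation.Unary.All.Properties as Allₚ
open import Data.List.Relation.Unary.Any using (here; there)
open import Data.Maybe.Base using (Maybe; just; nothing)
open import Data.Nat.Base as ℕ using (ℕ; zero; suc; _≤_; _<_; z≤n; s≤s)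
open import Data.Nat.Divisibility using (_∣_; _∤_; _∣?_; _∣0; ∣m+n∣m⇒∣n; m∣m*n; ∣1⇒≡1; >⇒∤)
import Data.Nat.Properties as ℕₚ
open import Data.Nat.Tactic.RingSolver using () renaming (solve-∀ to ℕ-solve-∀)
open import Data.Product.Base using (_×_; _,_; ∃-syntax; proj₁; proj₂; map₁)
open import Data.Product.Properties using () renaming (≡-dec to ×-≡-dec)
open import Data.Sum.Base using (_⊎_; inj₁; inj₂)
open import Data.Unit.Base using (⊤; tt)
import Data.Vec.Base as Vec
open import Function.Base using (_∘_)
open import Function.Definitions using (Injective)
open import Relation.Binary.Definitions using (DecidableEquality; tri<; tri≈; tri>)
open import Relation.Binary.PropositionalEquality as ≡ using (_≡_; _≢_)
open import Relation.Nullary using (¬_; Dec; yes; no)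
open import Relation.Nullary.Decidable using (decidable-stable; from-no; ¬?)

-- Rings of characteristic 3

data 𝔽₃ : Set where
  0̇ 1̇ 2̇ : 𝔽₃

next : 𝔽₃ → 𝔽₃
next 0̇ = 1̇
next 1̇ = 2̇
next 2̇ = 0̇

infixl 6 _+̇_
infixl 7 _*̇_

_+̇_ _*̇_ : 𝔽₃ → 𝔽₃ → 𝔽₃
0̇ +̇ y = y
1̇ +̇ y = next y
2̇ +̇ y = next (next y)
0̇ *̇ y = 0̇
1̇ *̇ y = y
2̇ *̇ y = y +̇ y

-̇_ : 𝔽₃ → 𝔽₃
-̇ 0̇ = 0̇
-̇ 1̇ = 2̇
-̇ 2̇ = 1̇

*̇-nonzero : ∀ {a b} → a ≢ 0̇ → b ≢ 0̇ → a *̇ b ≢ 0̇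
*̇-nonzero {0̇} a≢0 b≢0 _ = a≢0 ≡.refl
*̇-nonzero {1̇} a≢0 b≢0   = b≢0
*̇-nonzero {2̇} {0̇} a≢0 b≢0 _ = b≢0 ≡.refl

record Char3Ring : Set₁ where
  field
    ring : CommutativeRing 0ℓ 0ℓ
  open CommutativeRing ring public hiding (ring; zero)
  open Algebra.Properties.Semiring.Exp semiring public using (_^_; ^-congˡ)
  field
    1+1+1≈0 : 1# + 1# + 1# ≈ 0#

module Char3 (R : Char3Ring) where
  open Char3Ring R
  open import Relation.Binary.Reasoning.Setoid setoid

  ι : 𝔽₃ → Carrier
  ι 0̇ = 0#
  ι 1̇ = 1#
  ι 2̇ = 1# + 1#

  1+ι : ∀ c → 1# + ι c ≈ ι (next c)
  1+ι 0̇ = +-identityʳ 1#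
  1+ι 1̇ = refl
  1+ι 2̇ = trans (sym (+-assoc 1# 1# 1#)) 1+1+1≈0

  ι-+ : ∀ c d → ι (c +̇ d) ≈ ι c + ι d
  ι-+ 0̇ d = sym (+-identityˡ (ι d))
  ι-+ 1̇ d = sym (1+ι d)
  ι-+ 2̇ d = begin
    ι (next (next d)) ≈⟨ 1+ι (next d) ⟨
    1# + ι (next d)   ≈⟨ +-congˡ (1+ι d) ⟨
    1# + (1# + ι d)   ≈⟨ +-assoc 1# 1# (ι d) ⟨
    1# + 1# + ι d     ∎

  ι-* : ∀ c d → ι (c *̇ d) ≈ ι c * ι d
  ι-* 0̇ d = sym (zeroˡ (ι d))
  ι-* 1̇ d = sym (*-identityˡ (ι d))
  ι-* 2̇ d = begin
    ι (d +̇ d)             ≈⟨ ι-+ d d ⟩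
    ι d + ι d             ≈⟨ +-cong (*-identityˡ (ι d)) (*-identityˡ (ι d)) ⟨
    1# * ι d + 1# * ι d   ≈⟨ distribʳ (ι d) 1# 1# ⟨
    (1# + 1#) * ι d       ∎

  ι-- : ∀ c → ι (-̇ c) ≈ - ι c
  ι-- c = begin
    ι (-̇ c)                   ≈⟨ +-identityʳ _ ⟨
    ι (-̇ c) + 0#              ≈⟨ +-congˡ (-‿inverseʳ (ι c)) ⟨
    ι (-̇ c) + (ι c + - ι c)   ≈⟨ +-assoc _ _ _ ⟨
    ι (-̇ c) + ι c + - ι c     ≈⟨ +-congʳ (trans (sym (ι-+ (-̇ c) c)) (reflexive (≡.cong ι (cancel c)))) ⟩
    0# + - ι c                ≈⟨ +-identityˡ _ ⟩
    - ι c                     ∎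
    where
    cancel : ∀ c → -̇ c +̇ c ≡ 0̇
    cancel 0̇ = ≡.refl
    cancel 1̇ = ≡.refl
    cancel 2̇ = ≡.refl

  𝔽₃-rawRing : RawRing 0ℓ 0ℓ
  𝔽₃-rawRing = record
    { Carrier = 𝔽₃ ; _≈_ = _≡_ ; _+_ = _+̇_ ; _*_ = _*̇_ ; -_ = -̇_ ; 0# = 0̇ ; 1# = 1̇ }

  ι-morphism : 𝔽₃-rawRing -Raw-AlmostCommutative⟶ fromCommutativeRing ring
  ι-morphism = record
    { ⟦_⟧ = ι ; +-homo = ι-+ ; *-homo = ι-* ; -‿homo = ι-- ; 0-homo = refl ; 1-homo = refl }

  ι-≟ : ∀ c d → Maybe (ι c ≈ ι d)
  ι-≟ 0̇ 0̇ = just refl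
  ι-≟ 1̇ 1̇ = just refl
  ι-≟ 2̇ 2̇ = just refl
  ι-≟ _ _ = nothing

  -- With coefficients in 𝔽₃ the normal forms are reduced modulo 3, so Frobenius identities such as
  -- (x + y)³ = x³ + y³ are solved by `refl`.
  module 𝔽₃-Solver = Algebra.Solver.Ring 𝔽₃-rawRing (fromCommutativeRing ring) ι-morphism ι-≟
  open 𝔽₃-Solver

  frobenius-* : ∀ x y → (x * y) ^ 3 ≈ x ^ 3 * y ^ 3
  frobenius-* = solve 2 (λ x y → (x :* y) :^ 3 := x :^ 3 :* y :^ 3) refl

-- Polynomials in a transcendental element

-- No nonzero constant is a multiple of t, and t is not a zero divisor. Peeling off constant terms
-- one by one, this makes t transcendental over 𝔽₃, and it is easily checked for power series of
-- order one.
Transcendental : (R : Char3Ring) → Char3Ring.Carrier R → Set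
Transcendental R t = ∀ c r → ι c + t * r ≈ 0# → c ≡ 0̇ × r ≈ 0#
  where
  open Char3Ring R
  open Char3 R

module Degree (R : Char3Ring) (t : Char3Ring.Carrier R) (transcendental : Transcendental R t) where
  open Char3Ring R
  open Char3 R
  open 𝔽₃-Solver
  open import Relation.Binary.Reasoning.Setoid setoid

  -- Polynomials in t are ring elements that carry a Horner expansion, lowest coefficient first.
  -- Equality in the ring need not be decidable, so degrees are read off from the expansion; `Deg<`
  -- allows leading zeros, `Deg≡` does not.
  data Deg< : ℕ → Carrier → Set where
    null : ∀ {r} → r ≈ 0# → Deg< zero r
    step : ∀ {n r} c r′ → r ≈ ι c + t * r′ → Deg< n r′ → Deg< (suc n) r

  data Deg≡ : ℕ → Carrier → Set where
    const : ∀ {r} c → c ≢ 0̇ → r ≈ ι c → Deg≡ zero r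
    step  : ∀ {n r} c r′ → r ≈ ι c + t * r′ → Deg≡ n r′ → Deg≡ (suc n) r

  Deg<-resp : ∀ {n r s} → r ≈ s → Deg< n r → Deg< n s
  Deg<-resp r≈s (null r≈0)       = null (trans (sym r≈s) r≈0)
  Deg<-resp r≈s (step c r′ eq d) = step c r′ (trans (sym r≈s) eq) d

  Deg≡-resp : ∀ {n r s} → r ≈ s → Deg≡ n r → Deg≡ n s
  Deg≡-resp r≈s (const c c≢0 eq) = const c c≢0 (trans (sym r≈s) eq)
  Deg≡-resp r≈s (step c r′ eq d) = step c r′ (trans (sym r≈s) eq) d

  Deg<-0# : ∀ n {r} → r ≈ 0# → Deg< n r
  Deg<-0# zero    r≈0 = null r≈0
  Deg<-0# (suc n) r≈0 = step 0̇ 0# (trans r≈0 (solve 1 (λ x → con 0̇ := con 0̇ :+ x :* con 0̇) refl t)) (Deg<-0# n refl)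

  Deg<-mono : ∀ {m n r} → m ≤ n → Deg< m r → Deg< n r
  Deg<-mono z≤n       (null r≈0)       = Deg<-0# _ r≈0
  Deg<-mono (s≤s m≤n) (step c r′ eq d) = step c r′ eq (Deg<-mono m≤n d)

  Deg≡⇒Deg< : ∀ {n r} → Deg≡ n r → Deg< (suc n) r
  Deg≡⇒Deg< (const c _ eq)   =
    step c 0# (trans eq (solve 2 (λ c x → c := c :+ x :* con 0̇) refl (ι c) t)) (null refl)
  Deg≡⇒Deg< (step c r′ eq d) = step c r′ eq (Deg≡⇒Deg< d)

  step-+ : ∀ {r s} c r′ d s′ → r ≈ ι c + t * r′ → s ≈ ι d + t * s′ →
           r + s ≈ ι (c +̇ d) + t * (r′ + s′)
  step-+ {r} {s} c r′ d s′ r≈ s≈ = begin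
    r + s                             ≈⟨ +-cong r≈ s≈ ⟩
    (ι c + t * r′) + (ι d + t * s′)
      ≈⟨ solve 5 (λ c d x r s → (c :+ x :* r) :+ (d :+ x :* s) := (c :+ d) :+ x :* (r :+ s)) refl (ι c) (ι d) t r′ s′ ⟩
    (ι c + ι d) + t * (r′ + s′)       ≈⟨ +-congʳ (ι-+ c d) ⟨
    ι (c +̇ d) + t * (r′ + s′)         ∎

  Deg<-+ : ∀ {n r s} → Deg< n r → Deg< n s → Deg< n (r + s)
  Deg<-+ (null r≈0)       (null s≈0)       = null (trans (+-cong r≈0 s≈0) (+-identityˡ 0#))
  Deg<-+ (step c r′ r≈ p) (step d s′ s≈ q) = step (c +̇ d) _ (step-+ c r′ d s′ r≈ s≈) (Deg<-+ p q)

  Deg≡-+ : ∀ {n r s} → Deg≡ n r → Deg< n s → Deg≡ n (r + s)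
  Deg≡-+ (const c c≢0 r≈) (null s≈0)       = const c c≢0 (trans (+-cong r≈ s≈0) (+-identityʳ (ι c)))
  Deg≡-+ (step c r′ r≈ p) (step d s′ s≈ q) = step (c +̇ d) _ (step-+ c r′ d s′ r≈ s≈) (Deg≡-+ p q)

  step-* : ∀ {r} b c r′ → r ≈ ι c + t * r′ → ι b * r ≈ ι (b *̇ c) + t * (ι b * r′)
  step-* {r} b c r′ r≈ = begin
    ι b * r                         ≈⟨ *-congˡ r≈ ⟩
    ι b * (ι c + t * r′)            ≈⟨ solve 4 (λ b c x r → b :* (c :+ x :* r) := b :* c :+ x :* (b :* r)) refl (ι b) (ι c) t r′ ⟩
    ι b * ι c + t * (ι b * r′)      ≈⟨ +-congʳ (ι-* b c) ⟨
    ι (b *̇ c) + t * (ι b * r′)      ∎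

  Deg<-ι* : ∀ {n r} b → Deg< n r → Deg< n (ι b * r)
  Deg<-ι* b (null r≈0)       = null (trans (*-congˡ r≈0) (zeroʳ (ι b)))
  Deg<-ι* b (step c r′ r≈ p) = step (b *̇ c) _ (step-* b c r′ r≈) (Deg<-ι* b p)

  Deg≡-ι* : ∀ {n r b} → b ≢ 0̇ → Deg≡ n r → Deg≡ n (ι b * r)
  Deg≡-ι* {b = b} b≢0 (const c c≢0 r≈) = const _ (*̇-nonzero b≢0 c≢0) (trans (*-congˡ r≈) (sym (ι-* b c)))
  Deg≡-ι* {b = b} b≢0 (step c r′ r≈ p) = step (b *̇ c) _ (step-* b c r′ r≈) (Deg≡-ι* b≢0 p)

  Deg<-t* : ∀ {n r} → Deg< n r → Deg< (suc n) (t * r)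
  Deg<-t* p = step 0̇ _ (sym (+-identityˡ _)) p

  Deg≡-t* : ∀ {n r} → Deg≡ n r → Deg≡ (suc n) (t * r)
  Deg≡-t* p = step 0̇ _ (sym (+-identityˡ _)) p

  -‿ι* : ∀ r → ι 2̇ * r ≈ - r
  -‿ι* = solve 1 (λ r → con 2̇ :* r := :- r) refl

  Deg<-neg : ∀ {n r} → Deg< n r → Deg< n (- r)
  Deg<-neg p = Deg<-resp (-‿ι* _) (Deg<-ι* 2̇ p)

  expand-* : ∀ {r} s c r′ → r ≈ ι c + t * r′ → t * (r′ * s) + ι c * s ≈ r * s
  expand-* s c r′ r≈ = trans
    (solve 4 (λ c x r s → x :* (r :* s) :+ c :* s := (c :+ x :* r) :* s) refl (ι c) t r′ s)
    (sym (*-congʳ r≈))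

  -- In r s = t (r′ s) + c s the first summand has degree m + n + 1 and the second at most n, so the
  -- leading term of the first survives.
  Deg≡-* : ∀ {m n r s} → Deg≡ m r → Deg≡ n s → Deg≡ (m ℕ.+ n) (r * s)
  Deg≡-* (const c c≢0 r≈) q = Deg≡-resp (sym (*-congʳ r≈)) (Deg≡-ι* c≢0 q)
  Deg≡-* {suc m} {n} {s = s} (step c r′ r≈ p) q = Deg≡-resp (expand-* s c r′ r≈)
    (Deg≡-+ (Deg≡-t* (Deg≡-* p q))
            (Deg<-mono (s≤s (ℕₚ.m≤n+m n m)) (Deg<-ι* c (Deg≡⇒Deg< q))))

  Deg≡-^ : ∀ {m r} k → Deg≡ m r → Deg≡ (k ℕ.* m) (r ^ k)
  Deg≡-^ zero    p = const 1̇ (λ ()) refl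
  Deg≡-^ (suc k) p = Deg≡-* p (Deg≡-^ k p)

  -- Transcendence peels off one constant term after another until the nonzero leading coefficient
  -- is reached.
  Deg≡⇒≉0 : ∀ {n r} → Deg≡ n r → ¬ r ≈ 0#
  Deg≡⇒≉0 (const c c≢0 r≈) r≈0 = c≢0 (proj₁ (transcendental c 0#
    (trans (solve 2 (λ c x → c :+ x :* con 0̇ := c) refl (ι c) t) (trans (sym r≈) r≈0))))
  Deg≡⇒≉0 (step c r′ r≈ p) r≈0 = Deg≡⇒≉0 p (proj₂ (transcendental c r′ (trans (sym r≈) r≈0)))

  -- Otherwise r - r would have exact degree n.
  Deg≡⇒¬Deg< : ∀ {n r} → Deg≡ n r → ¬ Deg< n r
  Deg≡⇒¬Deg< p q = Deg≡⇒≉0 (Deg≡-+ p (Deg<-neg q)) (-‿inverseʳ _)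

  Deg≡-unique : ∀ {m n r} → Deg≡ m r → Deg≡ n r → m ≡ n
  Deg≡-unique {m} {n} p q with ℕₚ.<-cmp m n
  ... | tri< m<n _ _ = ⊥-elim (Deg≡⇒¬Deg< q (Deg<-mono m<n (Deg≡⇒Deg< p)))
  ... | tri≈ _ m≡n _ = m≡n
  ... | tri> _ _ n<m = ⊥-elim (Deg≡⇒¬Deg< p (Deg<-mono n<m (Deg≡⇒Deg< q)))

  IsPoly : Carrier → Set
  IsPoly r = ∃[ n ] Deg< n r

  -- The expansion has entries in 𝔽₃, where zero is recognised by matching; dropping leading zeros
  -- needs no decision in the ring itself.
  0⊎Deg≡ : ∀ {r} → IsPoly r → r ≈ 0# ⊎ ∃[ n ] Deg≡ n r
  0⊎Deg≡ (_ , null r≈0) = inj₁ r≈0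
  0⊎Deg≡ (_ , step c r′ r≈ p) with 0⊎Deg≡ (_ , p)
  0⊎Deg≡ (_ , step c  r′ r≈ p) | inj₂ (n , q) = inj₂ (suc n , step c r′ r≈ q)
  0⊎Deg≡ (_ , step 0̇ r′ r≈ p) | inj₁ r′≈0    = inj₁ (trans r≈ (trans (+-identityˡ _) (trans (*-congˡ r′≈0) (zeroʳ t))))
  0⊎Deg≡ (_ , step 1̇ r′ r≈ p) | inj₁ r′≈0    = inj₂ (0 , const 1̇ (λ ())
    (trans r≈ (trans (+-congˡ (trans (*-congˡ r′≈0) (zeroʳ t))) (+-identityʳ _))))
  0⊎Deg≡ (_ , step 2̇ r′ r≈ p) | inj₁ r′≈0    = inj₂ (0 , const 2̇ (λ ())
    (trans r≈ (trans (+-congˡ (trans (*-congˡ r′≈0) (zeroʳ t))) (+-identityʳ _))))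

  poly-resp : ∀ {r s} → r ≈ s → IsPoly r → IsPoly s
  poly-resp r≈s (n , p) = n , Deg<-resp r≈s p

  poly-Deg≡ : ∀ {n r} → Deg≡ n r → IsPoly r
  poly-Deg≡ p = _ , Deg≡⇒Deg< p

  poly-ι : ∀ c → IsPoly (ι c)
  poly-ι c = 1 , step c 0# (solve 2 (λ c x → c := c :+ x :* con 0̇) refl (ι c) t) (null refl)

  poly-t : IsPoly t
  poly-t = 2 , Deg<-resp (*-identityʳ t) (Deg<-t* (proj₂ (poly-ι 1̇)))

  poly-+ : ∀ {r s} → IsPoly r → IsPoly s → IsPoly (r + s)
  poly-+ (m , p) (n , q) =
    m ℕ.⊔ n , Deg<-+ (Deg<-mono (ℕₚ.m≤m⊔n m n) p) (Deg<-mono (ℕₚ.m≤n⊔m m n) q)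

  poly-neg : ∀ {r} → IsPoly r → IsPoly (- r)
  poly-neg (n , p) = n , Deg<-neg p

  poly-* : ∀ {r s} → IsPoly r → IsPoly s → IsPoly (r * s)
  poly-* (_ , null r≈0) _ = 0 , null (trans (*-congʳ r≈0) (zeroˡ _))
  poly-* {s = s} (_ , step c r′ r≈ p) (n , q) = poly-resp (expand-* s c r′ r≈)
    (poly-+ (_ , Deg<-t* (proj₂ (poly-* (_ , p) (n , q)))) (n , Deg<-ι* c q))

  poly-^ : ∀ {r} k → IsPoly r → IsPoly (r ^ k)
  poly-^ zero    p = poly-ι 1̇
  poly-^ (suc k) p = poly-* p (poly-^ k p)

-- Formal linear combinations

module Combination (R : Char3Ring) {A : Set} (_≟_ : DecidableEquality A) where
  open Char3Ring R
  open Char3 R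
  open 𝔽₃-Solver
  open import Relation.Binary.Reasoning.Setoid setoid

  -- Labels may repeat and `coef` adds up their coefficients, so concatenation serves as addition.
  Combo : Set
  Combo = List (Carrier × A)

  [_]_ : ∀ {P : Set} → Dec P → Carrier → Carrier
  [ yes _ ] c = c
  [ no _  ] c = 0#

  []-yes : ∀ {P : Set} (P? : Dec P) {c} → P → [ P? ] c ≈ c
  []-yes (yes _) p = refl
  []-yes (no ¬p) p = ⊥-elim (¬p p)

  []-no : ∀ {P : Set} (P? : Dec P) {c} → ¬ P → [ P? ] c ≈ 0#
  []-no (yes p) ¬p = ⊥-elim (¬p p)
  []-no (no _)  ¬p = refl

  coef : Combo → A → Carrier
  coef []            a = 0#
  coef ((c , b) ∷ L) a = [ b ≟ a ] c + coef L a

  eval : (A → Carrier) → Combo → Carrier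
  eval f []            = 0#
  eval f ((c , a) ∷ L) = c * f a + eval f L

  mapCoef : (Carrier → Carrier) → Combo → Combo
  mapCoef φ = List.map (map₁ φ)

  coef-++ : ∀ L M a → coef (L ++ M) a ≈ coef L a + coef M a
  coef-++ []            M a = sym (+-identityˡ _)
  coef-++ ((c , b) ∷ L) M a = trans (+-congˡ (coef-++ L M a)) (sym (+-assoc _ _ _))

  eval-++ : ∀ f L M → eval f (L ++ M) ≈ eval f L + eval f M
  eval-++ f []            M = sym (+-identityˡ _)
  eval-++ f ((c , b) ∷ L) M = trans (+-congˡ (eval-++ f L M)) (sym (+-assoc _ _ _))

  coef-map : ∀ φ → φ 0# ≈ 0# → (∀ {x y} → x ≈ y → φ x ≈ φ y) → (∀ x y → φ (x + y) ≈ φ x + φ y) →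
             ∀ L a → coef (mapCoef φ L) a ≈ φ (coef L a)
  coef-map φ φ-0 φ-cong φ-+ []            a = sym φ-0
  coef-map φ φ-0 φ-cong φ-+ ((c , b) ∷ L) a = begin
    [ b ≟ a ] φ c + coef (mapCoef φ L) a   ≈⟨ +-cong (outside (b ≟ a)) (coef-map φ φ-0 φ-cong φ-+ L a) ⟩
    φ ([ b ≟ a ] c) + φ (coef L a)         ≈⟨ φ-+ _ _ ⟨
    φ ([ b ≟ a ] c + coef L a)             ∎
    where
    outside : ∀ {P : Set} (P? : Dec P) → [ P? ] φ c ≈ φ ([ P? ] c)
    outside (yes _) = refl
    outside (no _)  = sym φ-0

  eval-scale : ∀ f k L → eval f (mapCoef (k *_) L) ≈ k * eval f L
  eval-scale f k []            = sym (zeroʳ k)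
  eval-scale f k ((c , a) ∷ L) = begin
    k * c * f a + eval f (mapCoef (k *_) L)   ≈⟨ +-cong (*-assoc k c (f a)) (eval-scale f k L) ⟩
    k * (c * f a) + k * eval f L              ≈⟨ distribˡ k _ _ ⟨
    k * (c * f a + eval f L)                  ∎

  -- By Frobenius c ↦ -c³ is additive, and -c³ y³ = -(c y)³ in each term.
  eval-negCube : ∀ f L → eval (λ a → f a ^ 3) (mapCoef (λ c → - c ^ 3) L) ≈ - eval f L ^ 3
  eval-negCube f []            = solve 0 (con 0̇ := :- con 0̇ :^ 3) refl
  eval-negCube f ((c , a) ∷ L) = trans (+-congˡ (eval-negCube f L))
    (solve 3 (λ c y z → :- c :^ 3 :* y :^ 3 :+ :- z :^ 3 := :- (c :* y :+ z) :^ 3) refl c (f a) (eval f L))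

  remove : A → Combo → Combo
  remove a [] = []
  remove a ((c , b) ∷ L) with b ≟ a
  ... | yes _ = remove a L
  ... | no _  = (c , b) ∷ remove a L

  eval-remove : ∀ f a L → eval f L ≈ coef L a * f a + eval f (remove a L)
  eval-remove f a [] = solve 1 (λ x → con 0̇ := con 0̇ :* x :+ con 0̇) refl (f a)
  eval-remove f a ((c , b) ∷ L) with b ≟ a
  ... | yes ≡.refl = trans (+-congˡ (eval-remove f a L))
    (solve 4 (λ c y d z → c :* y :+ (d :* y :+ z) := (c :+ d) :* y :+ z) refl c (f a) (coef L a) (eval f (remove a L)))
  ... | no _ = trans (+-congˡ (eval-remove f a L))
    (solve 4 (λ c d y z → c :+ (d :* y :+ z) := (con 0̇ :+ d) :* y :+ (c :+ z)) refl (c * f b) (coef L a) (f a) (eval f (remove a L)))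

  coef-remove : ∀ {a b} L → b ≢ a → coef (remove a L) b ≈ coef L b
  coef-remove []            b≢a = refl
  coef-remove {a} {b} ((c , d) ∷ L) b≢a with d ≟ a
  ... | yes ≡.refl = begin
    coef (remove a L) b         ≈⟨ coef-remove L b≢a ⟩
    coef L b                    ≈⟨ +-identityˡ _ ⟨
    0# + coef L b               ≈⟨ +-congʳ ([]-no (d ≟ b) (b≢a ∘ ≡.sym)) ⟨
    [ d ≟ b ] c + coef L b      ∎
  ... | no _ = +-congˡ (coef-remove L b≢a)

  All-remove : ∀ {P Q : Carrier × A → Set} {a L} → (∀ {c b} → b ≢ a → P (c , b) → Q (c , b)) →
               All P L → All Q (remove a L)
  All-remove P⇒Q [] = []
  All-remove {a = a} {L = (c , b) ∷ L} P⇒Q (p ∷ ps) with b ≟ a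
  ... | yes _   = All-remove P⇒Q ps
  ... | no  b≢a = P⇒Q b≢a p ∷ All-remove P⇒Q ps

  coef-absent : ∀ {P : A → Set} {a L} → All (P ∘ proj₂) L → ¬ P a → coef L a ≈ 0#
  coef-absent {L = []}          []       ¬Pa = refl
  coef-absent {P} {L = (c , b) ∷ L} (p ∷ ps) ¬Pa = trans
    (+-cong ([]-no (b ≟ _) λ b≡a → ¬Pa (≡.subst P b≡a p)) (coef-absent ps ¬Pa)) (+-identityˡ 0#)

  coef-closed : ∀ {P : Carrier → Set} → P 0# → (∀ {x y} → P x → P y → P (x + y)) →
                ∀ {L} → All (P ∘ proj₁) L → ∀ a → P (coef L a)
  coef-closed P-0 P-+ []       a = P-0
  coef-closed {P} P-0 P-+ {(c , b) ∷ L} (p ∷ ps) a = P-+ (pick (b ≟ a)) (coef-closed {P} P-0 P-+ ps a)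
    where
    pick : ∀ {Q : Set} (Q? : Dec Q) → P ([ Q? ] c)
    pick (yes _) = p
    pick (no _)  = P-0

-- Artin–Schreier towers

_≟ᴸ_ : DecidableEquality (List ℕ)
_≟ᴸ_ = Listₚ.≡-dec ℕₚ._≟_

-- Tuples are added in order of length, after their tails: this makes the span of the h a,
-- a ∈ ws, contain their cubes.
data Stair : List (List ℕ) → Set where
  base : Stair ([] ∷ [])
  step : ∀ {ws e b} → 3 ∤ e → b ∈ ws → All (λ a → length a ≤ suc (length b)) ws →
         Stair ws → Stair ((e ∷ b) ∷ ws)

stair-∤ : ∀ {ws a} → Stair ws → a ∈ ws → All (3 ∤_) a
stair-∤ base                (here ≡.refl) = []
stair-∤ (step 3∤e b∈ws _ s) (here ≡.refl) = 3∤e ∷ stair-∤ s b∈ws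
stair-∤ (step _ _ _ s)      (there a∈ws)  = stair-∤ s a∈ws

stair-tail : ∀ {ws e b} → Stair ws → e ∷ b ∈ ws → b ∈ ws
stair-tail base             (here ())
stair-tail base             (there ())
stair-tail (step _ b∈ws _ _) (here ≡.refl) = there b∈ws
stair-tail (step _ _ _ s)    (there eb∈ws) = there (stair-tail s eb∈ws)

-- The right-hand side is 3 (n + E) + E, congruent to E modulo 3. In `no-root` the two sides are the
-- degrees of c³ and g² d.
degrees-differ : ∀ {n k E} → 3 ∤ E → 3 ℕ.* k ≢ 2 ℕ.* n ℕ.+ (n ℕ.+ E ℕ.* 4)
degrees-differ {n} {k} {E} 3∤E eq = 3∤E (∣m+n∣m⇒∣n (≡.subst (3 ∣_) (≡.trans eq (regroup n E)) (m∣m*n k)) (m∣m*n (n ℕ.+ E)))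
  where
  regroup : ∀ n E → 2 ℕ.* n ℕ.+ (n ℕ.+ E ℕ.* 4) ≡ 3 ℕ.* (n ℕ.+ E) ℕ.+ E
  regroup = ℕ-solve-∀

2*m+m≡3*m : ∀ m → 2 ℕ.* m ℕ.+ m ≡ 3 ℕ.* m
2*m+m≡3*m = ℕ-solve-∀

-- If c³ has smaller degree than g² d, then c has smaller degree than d, and d alone fixes the
-- degree of c + d.
degree-< : ∀ {n k d} → n ≤ d → 3 ℕ.* k < 2 ℕ.* n ℕ.+ d → k < d
degree-< {n} {k} {d} n≤d lt = ℕₚ.*-cancelˡ-< 3 k d (ℕₚ.<-≤-trans lt
  (ℕₚ.≤-trans (ℕₚ.+-monoˡ-≤ d (ℕₚ.*-monoʳ-≤ 2 n≤d)) (ℕₚ.≤-reflexive (2*m+m≡3*m d))))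

-- If c³ has larger degree than g² d, then k > n, and c³ also has larger degree than g² c.
degree-> : ∀ {n k d} → n ≤ d → 2 ℕ.* n ℕ.+ d < 3 ℕ.* k → 2 ℕ.* n ℕ.+ k < 3 ℕ.* k
degree-> {n} {k} {d} n≤d lt =
  ≡.subst (2 ℕ.* n ℕ.+ k <_) (2*m+m≡3*m k) (ℕₚ.+-monoˡ-< k (ℕₚ.*-monoʳ-< 2 n<k))
  where
  n<k : n < k
  n<k = ℕₚ.*-cancelˡ-< 3 n k (ℕₚ.≤-<-trans
    (ℕₚ.≤-trans (ℕₚ.≤-reflexive (≡.sym (2*m+m≡3*m n))) (ℕₚ.+-monoʳ-≤ (2 ℕ.* n) n≤d)) lt)

degree-≡ : ∀ {n k} → 3 ℕ.* k ≡ 2 ℕ.* n ℕ.+ k → k ≡ n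
degree-≡ {n} {k} eq =
  ℕₚ.*-cancelˡ-≡ k n 2 (ℕₚ.+-cancelʳ-≡ k (2 ℕ.* k) (2 ℕ.* n) (≡.trans (2*m+m≡3*m k) eq))

-- h is indexed by reversed tuples: the exponent of the innermost index comes first.
record ArtinSchreierTower (R : Char3Ring) (x : Char3Ring.Carrier R) (h : List ℕ → Char3Ring.Carrier R) : Set where
  open Char3Ring R
  field
    h-[] : h [] ≈ 1#
    h-∷  : ∀ {e b} → All (3 ∤_) (e ∷ b) → h (e ∷ b) ≈ h (e ∷ b) ^ 3 + x ^ e * h b ^ 3

module ArtinSchreier
  (R : Char3Ring)
  (t : Char3Ring.Carrier R) (transcendental : Transcendental R t)
  (x : Char3Ring.Carrier R) (deg-x : Degree.Deg≡ R t transcendental 4 x)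
  (h : List ℕ → Char3Ring.Carrier R) (h-tower : ArtinSchreierTower R x h)
  where
  open ArtinSchreierTower h-tower
  open Char3Ring R
  open Char3 R
  open 𝔽₃-Solver
  open Degree R t transcendental
  open Combination R _≟ᴸ_
  open import Relation.Binary.Reasoning.Setoid setoid

  poly-x : IsPoly x
  poly-x = poly-Deg≡ deg-x

  h³ : List ℕ → Carrier
  h³ a = h a ^ 3

  Over : List (List ℕ) → Combo → Set
  Over ws = All (λ p → IsPoly (proj₁ p) × proj₂ p ∈ ws)

  -- The family is a parameter because the induction carries h and its cubes together.
  Independent : (List ℕ → Carrier) → List (List ℕ) → Set
  Independent f ws = ∀ L → Over ws L → eval f L ≈ 0# → ∀ a → coef L a ≈ 0#

  poly-coef : ∀ {ws L} → Over ws L → ∀ a → IsPoly (coef L a)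
  poly-coef over = coef-closed {IsPoly} (poly-ι 0̇) poly-+ (All.map proj₁ over)

  -- Collects the terms c x ^ e h(b)³ that appear when each h (e ∷ b) is replaced by its
  -- Artin-Schreier expression; h [] equals its own cube and contributes nothing.
  shift : Combo → Combo
  shift []                  = []
  shift ((c , [])    ∷ L) = shift L
  shift ((c , e ∷ b) ∷ L) = (c * x ^ e , b) ∷ shift L

  eval-shift : ∀ L → All (All (3 ∤_) ∘ proj₂) L → eval h L ≈ eval h³ L + eval h³ (shift L)
  eval-shift [] [] = sym (+-identityˡ 0#)
  eval-shift ((c , []) ∷ L) (_ ∷ good) = trans (+-cong (*-congˡ h-[]³) (eval-shift L good)) (sym (+-assoc _ _ _))
    where
    h-[]³ : h [] ≈ h [] ^ 3
    h-[]³ = trans h-[] (trans (solve 0 (con 1̇ := con 1̇ :^ 3) refl) (^-congˡ 3 (sym h-[])))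
  eval-shift ((c , e ∷ b) ∷ L) (g ∷ good) = trans (+-cong (*-congˡ (h-∷ g)) (eval-shift L good))
    (solve 6 (λ c y p z u v → c :* (y :+ p :* z) :+ (u :+ v) := (c :* y :+ u) :+ (c :* p :* z :+ v)) refl
      c (h³ (e ∷ b)) (x ^ e) (h³ b) (eval h³ L) (eval h³ (shift L)))

  All-shift : ∀ {P Q : Carrier × List ℕ → Set} → (∀ {c e b} → P (c , e ∷ b) → Q (c * x ^ e , b)) →
              ∀ {L} → All P L → All Q (shift L)
  All-shift f {[]}                [] = []
  All-shift f {(c , [])    ∷ L} (_ ∷ ps) = All-shift f ps
  All-shift f {(c , e ∷ b) ∷ L} (p ∷ ps) = f p ∷ All-shift f ps

  ∑x : (ℕ → Carrier) → ℕ → Carrier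
  ∑x f zero    = 0#
  ∑x f (suc B) = ∑x f B + f B * x ^ B

  ∑x-0 : ∀ {f} B → (∀ e → e < B → f e ≈ 0#) → ∑x f B ≈ 0#
  ∑x-0 zero    f≈0 = refl
  ∑x-0 (suc B) f≈0 = trans
    (+-cong (∑x-0 B λ e e<B → f≈0 e (ℕₚ.m≤n⇒m≤1+n e<B)) (trans (*-congʳ (f≈0 B ℕₚ.≤-refl)) (zeroˡ _))) (+-identityˡ 0#)

  ∑x-+ : ∀ f g B → ∑x (λ e → f e + g e) B ≈ ∑x f B + ∑x g B
  ∑x-+ f g zero    = sym (+-identityˡ 0#)
  ∑x-+ f g (suc B) = trans (+-congʳ (∑x-+ f g B))
    (solve 5 (λ u v f g p → (u :+ v) :+ (f :+ g) :* p := (u :+ f :* p) :+ (v :+ g :* p)) refl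
      (∑x f B) (∑x g B) (f B) (g B) (x ^ B))

  ∑x-single : ∀ {f e B} → e < B → (∀ e′ → e′ ≢ e → f e′ ≈ 0#) → ∑x f B ≈ f e * x ^ e
  ∑x-single {f} {e} {suc B} (s≤s e≤B) f≈0 with ℕₚ.m≤n⇒m<n∨m≡n e≤B
  ... | inj₁ e<B = trans (+-cong (∑x-single e<B f≈0) (trans (*-congʳ (f≈0 B (ℕₚ.<⇒≢ e<B ∘ ≡.sym))) (zeroˡ _))) (+-identityʳ _)
  ... | inj₂ ≡.refl = trans (+-congʳ (∑x-0 B λ e′ e′<B → f≈0 e′ (ℕₚ.<⇒≢ e′<B))) (+-identityˡ _)

  HeadBelow : ℕ → List ℕ → Set
  HeadBelow B []      = ⊤
  HeadBelow B (e ∷ _) = e < B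

  headBelow-mono : ∀ {B B′ a} → B ≤ B′ → HeadBelow B a → HeadBelow B′ a
  headBelow-mono {a = []}    B≤B′ _   = tt
  headBelow-mono {a = _ ∷ _} B≤B′ e<B = ℕₚ.<-≤-trans e<B B≤B′

  -- The coefficient at b comes from all tuples e ∷ b; a bound B on the heads makes this a finite
  -- sum.
  coef-shift : ∀ {B} b L → All (HeadBelow B ∘ proj₂) L → coef (shift L) b ≈ ∑x (λ e → coef L (e ∷ b)) B
  coef-shift {B} b [] [] = sym (∑x-0 B λ _ _ → refl)
  coef-shift {B} b ((c , []) ∷ L) (_ ∷ below) = begin
    coef (shift L) b                                                          ≈⟨ coef-shift b L below ⟩
    ∑x (λ e → coef L (e ∷ b)) B                                               ≈⟨ +-identityˡ _ ⟨
    0# + ∑x (λ e → coef L (e ∷ b)) B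
      ≈⟨ +-congʳ (∑x-0 B λ e _ → []-no ([] ≟ᴸ (e ∷ b)) {c} λ ()) ⟨
    ∑x (λ e → [ [] ≟ᴸ (e ∷ b) ] c) B + ∑x (λ e → coef L (e ∷ b)) B            ≈⟨ ∑x-+ _ _ B ⟨
    ∑x (λ e → [ [] ≟ᴸ (e ∷ b) ] c + coef L (e ∷ b)) B                         ∎
  coef-shift {B} b ((c , e₀ ∷ b₀) ∷ L) (e₀<B ∷ below) = begin
    [ b₀ ≟ᴸ b ] (c * x ^ e₀) + coef (shift L) b                               ≈⟨ +-cong (head (b₀ ≟ᴸ b)) (coef-shift b L below) ⟩
    ∑x (λ e → [ (e₀ ∷ b₀) ≟ᴸ (e ∷ b) ] c) B + ∑x (λ e → coef L (e ∷ b)) B     ≈⟨ ∑x-+ _ _ B ⟨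
    ∑x (λ e → [ (e₀ ∷ b₀) ≟ᴸ (e ∷ b) ] c + coef L (e ∷ b)) B                  ∎
    where
    head : (b₀≟b : Dec (b₀ ≡ b)) → [ b₀≟b ] (c * x ^ e₀) ≈ ∑x (λ e → [ (e₀ ∷ b₀) ≟ᴸ (e ∷ b) ] c) B
    head (yes ≡.refl) = sym (trans
      (∑x-single e₀<B λ e e≢e₀ → []-no ((e₀ ∷ b₀) ≟ᴸ (e ∷ b₀)) λ eq → e≢e₀ (≡.sym (Listₚ.∷-injectiveˡ eq)))
      (*-congʳ ([]-yes ((e₀ ∷ b₀) ≟ᴸ (e₀ ∷ b₀)) ≡.refl)))
    head (no b₀≢b)    = sym (∑x-0 B λ e _ → []-no ((e₀ ∷ b₀) ≟ᴸ (e ∷ b)) (b₀≢b ∘ Listₚ.∷-injectiveʳ))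

  head-bound : (L : Combo) → ∃[ B ] All (HeadBelow B ∘ proj₂) L
  head-bound [] = 0 , []
  head-bound ((c , []) ∷ L) with head-bound L
  ... | B , below = B , tt ∷ below
  head-bound ((c , e ∷ b) ∷ L) with head-bound L
  ... | B , below = suc e ℕ.⊔ B ,
    ℕₚ.m≤m⊔n (suc e) B ∷ All.map (λ {(_ , a)} → headBelow-mono {a = a} (ℕₚ.m≤n⊔m (suc e) B)) below

  module _ {n} {f : ℕ → Carrier} (f-deg : ∀ e → f e ≈ 0# ⊎ Deg≡ n (f e)) where

    deg-term : ∀ {e} → Deg≡ n (f e) → Deg≡ (n ℕ.+ e ℕ.* 4) (f e * x ^ e)
    deg-term {e} p = Deg≡-* p (Deg≡-^ e deg-x)

    term-0 : ∀ {e} → f e ≈ 0# → f e * x ^ e ≈ 0#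
    term-0 f≈0 = trans (*-congʳ f≈0) (zeroˡ _)

    Deg<-∑x : ∀ B → Deg< (n ℕ.+ B ℕ.* 4) (∑x f B)
    Deg<-∑x zero    = Deg<-0# _ refl
    Deg<-∑x (suc B) = Deg<-+ (Deg<-mono (ℕₚ.+-monoʳ-≤ n (ℕₚ.m≤n+m (B ℕ.* 4) 4)) (Deg<-∑x B)) last
      where
      last : Deg< (n ℕ.+ suc B ℕ.* 4) (f B * x ^ B)
      last with f-deg B
      ... | inj₁ f≈0 = Deg<-0# _ (term-0 f≈0)
      ... | inj₂ p   = Deg<-mono (ℕₚ.+-monoʳ-< n (ℕₚ.m≤n+m (suc (B ℕ.* 4)) 3)) (Deg≡⇒Deg< (deg-term p))

    -- The nonzero terms have degrees n + 4e, distinct for distinct e, so the last of them fixes the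
    -- degree. Its exponent E is prime to 3 since f vanishes at multiples of 3; the given nonzero
    -- term ensures that there is one.
    Deg≡-∑x : (∀ e → 3 ∣ e → f e ≈ 0#) → ∀ {e B} → e < B → Deg≡ n (f e) →
              ∃[ E ] 3 ∤ E × Deg≡ (n ℕ.+ E ℕ.* 4) (∑x f B)
    Deg≡-∑x 3∣⇒0 {e} {suc B} (s≤s e≤B) p with f-deg B
    ... | inj₂ q = B , (λ 3∣B → Deg≡⇒≉0 q (3∣⇒0 B 3∣B)) ,
                   Deg≡-resp (+-comm _ _) (Deg≡-+ (deg-term q) (Deg<-∑x B))
    ... | inj₁ f≈0 with ℕₚ.m≤n⇒m<n∨m≡n e≤B
    ...   | inj₂ ≡.refl = ⊥-elim (Deg≡⇒≉0 p f≈0)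
    ...   | inj₁ e<B with Deg≡-∑x 3∣⇒0 e<B p
    ...     | E , 3∤E , q = E , 3∤E , Deg≡-resp (sym (trans (+-congˡ (term-0 f≈0)) (+-identityʳ _))) q

  -- In 𝔽₃(t) this says that (c/g)³ − c/g = d/g has no solution: at t = ∞ the right-hand
  -- side has a pole of order 4E with 3 ∤ E.
  no-root : ∀ {n k E g c d} → 3 ∤ E → Deg≡ n g → Deg≡ k c → Deg≡ (n ℕ.+ E ℕ.* 4) d →
            ¬ g ^ 2 * (c + d) ≈ c ^ 3
  no-root {n} {k} {E} {g} {c} {d} 3∤E deg-g deg-c deg-d eq with ℕₚ.<-cmp (3 ℕ.* k) (2 ℕ.* n ℕ.+ (n ℕ.+ E ℕ.* 4))
  ... | tri≈ _ 3k≡ _ = degrees-differ {n} {k} 3∤E 3k≡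
  ... | tri< 3k< _ _ = degrees-differ {n} {k} 3∤E (Deg≡-unique (Deg≡-^ 3 deg-c)
    (Deg≡-resp eq (Deg≡-* (Deg≡-^ 2 deg-g) (Deg≡-resp (+-comm d c)
      (Deg≡-+ deg-d (Deg<-mono (degree-< {n} (ℕₚ.m≤m+n n _) 3k<) (Deg≡⇒Deg< deg-c)))))))
  ... | tri> _ _ 3k> = Deg≡⇒¬Deg< (Deg≡-^ 3 deg-c) (Deg<-resp (trans (sym (distribˡ _ c d)) eq)
    (Deg<-+ (Deg<-mono (degree-> {n} (ℕₚ.m≤m+n n _) 3k>) (Deg≡⇒Deg< (Deg≡-* (Deg≡-^ 2 deg-g) deg-c)))
            (Deg<-mono 3k> (Deg≡⇒Deg< (Deg≡-* (Deg≡-^ 2 deg-g) deg-d)))))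

  -- For y = c/g the equation is y³ = y, with constant solutions only; what is extracted is that c
  -- is zero or has the degree of g.
  constant-root : ∀ {n g c} → IsPoly c → Deg≡ n g → g ^ 2 * c ≈ c ^ 3 → c ≈ 0# ⊎ Deg≡ n c
  constant-root {n} {g} {c} poly-c deg-g eq with 0⊎Deg≡ poly-c
  ... | inj₁ c≈0 = inj₁ c≈0
  ... | inj₂ (k , deg-c) = inj₂ (≡.subst (λ k → Deg≡ k c) k≡n deg-c)
    where
    k≡n : k ≡ n
    k≡n = degree-≡ (Deg≡-unique (Deg≡-^ 3 deg-c) (Deg≡-resp eq (Deg≡-* (Deg≡-^ 2 deg-g) deg-c)))

  -- Rewrites h(e ∷ b)³ as h(e ∷ b) - x ^ e h(b)³ and recurses on the tail b, which stays in ws,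
  -- down to h []³ = h [].
  cube∈span : ∀ {ws} → Stair ws → ∀ a → a ∈ ws → ∀ {c} → IsPoly c →
              ∃[ L ] Over ws L × eval h L ≈ c * h³ a
  cube∈span s [] a∈ws {c} poly-c = (c , []) ∷ [] , (poly-c , a∈ws) ∷ [] ,
    trans (+-congʳ (*-congˡ h-[])) (trans (solve 1 (λ c → c :* con 1̇ :+ con 0̇ := c :* con 1̇ :^ 3) refl c)
      (*-congˡ (^-congˡ 3 (sym h-[]))))
  cube∈span s (e ∷ b) a∈ws {c} poly-c
    with cube∈span s b (stair-tail s a∈ws) (poly-neg (poly-* poly-c (poly-^ e poly-x)))
  ... | L , over , eq = (c , e ∷ b) ∷ L , (poly-c , a∈ws) ∷ over ,
    trans (+-cong (*-congˡ (h-∷ (stair-∤ s a∈ws))) eq)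
      (solve 4 (λ c y p z → c :* (y :+ p :* z) :+ (:- (c :* p)) :* z := c :* y) refl c (h³ (e ∷ b)) (x ^ e) (h³ b))

  cubes⊂span : ∀ {ws} → Stair ws → ∀ {M} → Over ws M → ∃[ L ] Over ws L × eval h L ≈ eval h³ M
  cubes⊂span s [] = [] , [] , refl
  cubes⊂span s {(c , a) ∷ M} ((poly-c , a∈ws) ∷ over)
    with cube∈span s a a∈ws poly-c | cubes⊂span s over
  ... | L , overL , eqL | L′ , overL′ , eqL′ =
    L ++ L′ , Allₚ.++⁺ overL overL′ , trans (eval-++ h L L′) (+-cong eqL eqL′)

  remove-over : ∀ {m ws L} → Over (m ∷ ws) L → Over ws (remove m L)
  remove-over {m} {ws} = All-remove (λ { b≢m (p , here b≡m) → ⊥-elim (b≢m b≡m) ; _ (p , there b∈ws) → p , b∈ws })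

  -- When the coefficient at m vanishes, deleting m from L leaves a relation over ws.
  independent-∷ : ∀ {f m ws} → Independent f ws → ∀ L → Over (m ∷ ws) L → coef L m ≈ 0# → eval f L ≈ 0# →
                  ∀ a → coef L a ≈ 0#
  independent-∷ {f} {m} ind L over g≈0 eq a with a ≟ᴸ m
  ... | yes ≡.refl = g≈0
  ... | no a≢m = trans (sym (coef-remove L a≢m)) (ind (remove m L) (remove-over over) rest a)
    where
    rest : eval f (remove m L) ≈ 0#
    rest = begin
      eval f (remove m L)                       ≈⟨ +-identityˡ _ ⟨
      0# + eval f (remove m L)                  ≈⟨ +-congʳ (trans (*-congʳ g≈0) (zeroˡ _)) ⟨
      coef L m * f m + eval f (remove m L)      ≈⟨ eval-remove f m L ⟨
      eval f L                                  ≈⟨ eq ⟩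
      0#                                        ∎

  -- A nonzero coefficient g at m is refuted by degrees: `relation` forces the coefficients at the
  -- tuples e′ ∷ b to be zero or of the degree of g, and at b it then contradicts `no-root`.
  independent-h : ∀ {e b ws} → Stair ((e ∷ b) ∷ ws) → Independent h ws → Independent h³ ws →
                  Independent h ((e ∷ b) ∷ ws)
  independent-h {e} {b} {ws} stair@(step 3∤e b∈ws short s) ind ind³ L over evalL≈0 with 0⊎Deg≡ (poly-coef over (e ∷ b))
  ... | inj₁ g≈0 = independent-∷ ind L over g≈0 evalL≈0
  ... | inj₂ (n , deg-g) = ⊥-elim contradiction
    where
    m = e ∷ b
    g = coef L m
    S = shift L
    -- g² times the relation with each h expanded into cubes, minus the cube of the relation. The
    -- factor g² makes the coefficient at m equal to g² g - g³ = 0.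
    M = mapCoef (g ^ 2 *_) (L ++ S) ++ mapCoef (λ c → - c ^ 3) L

    good : All (All (3 ∤_) ∘ proj₂) L
    good = All.map (stair-∤ stair ∘ proj₂) over

    eval-M : eval h³ M ≈ 0#
    eval-M = begin
      eval h³ M
        ≈⟨ eval-++ h³ (mapCoef (g ^ 2 *_) (L ++ S)) _ ⟩
      eval h³ (mapCoef (g ^ 2 *_) (L ++ S)) + eval h³ (mapCoef (λ c → - c ^ 3) L)
        ≈⟨ +-cong (eval-scale h³ (g ^ 2) (L ++ S)) (eval-negCube h L) ⟩
      g ^ 2 * eval h³ (L ++ S) + - eval h L ^ 3
        ≈⟨ +-cong (*-congˡ (trans (eval-++ h³ L S) (trans (sym (eval-shift L good)) evalL≈0))) (-‿cong (^-congˡ 3 evalL≈0)) ⟩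
      g ^ 2 * 0# + - 0# ^ 3
        ≈⟨ solve 1 (λ g → g :^ 2 :* con 0̇ :+ :- con 0̇ :^ 3 := con 0̇) refl g ⟩
      0#                                                                              ∎

    coef-M : ∀ a → coef M a ≈ g ^ 2 * (coef L a + coef S a) + - coef L a ^ 3
    coef-M a = trans (coef-++ (mapCoef (g ^ 2 *_) (L ++ S)) _ a) (+-cong
      (trans (coef-map (g ^ 2 *_) (zeroʳ _) *-congˡ (distribˡ _) (L ++ S) a) (*-congˡ (coef-++ L S a)))
      (coef-map (λ c → - c ^ 3) (solve 0 (:- con 0̇ :^ 3 := con 0̇) refl) (-‿cong ∘ ^-congˡ 3)
        (solve 2 (λ x y → :- (x :+ y) :^ 3 := :- x :^ 3 :+ :- y :^ 3) refl) L a))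

    over-S : Over (m ∷ ws) S
    over-S = All-shift (λ {c} {e′} (p , a∈ws) → poly-* p (poly-^ e′ poly-x) , stair-tail stair a∈ws) over

    over-M : Over (m ∷ ws) M
    over-M = Allₚ.++⁺
      (Allₚ.map⁺ (All.map (λ (p , a∈ws) → poly-* (poly-^ 2 (poly-Deg≡ deg-g)) p , a∈ws) (Allₚ.++⁺ over over-S)))
      (Allₚ.map⁺ (All.map (λ (p , a∈ws) → poly-neg (poly-^ 3 p) , a∈ws) over))

    length≤ : ∀ {a} → a ∈ m ∷ ws → length a ≤ length m
    length≤ (here ≡.refl) = ℕₚ.≤-refl
    length≤ (there a∈ws)  = All.lookup short a∈ws

    -- Every tuple in S has lost an entry of a tuple no longer than m, hence is strictly shorter
    -- than m.
    coef-S-top : ∀ e′ → coef S (e′ ∷ b) ≈ 0#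
    coef-S-top e′ = coef-absent {λ a → length a < length m}
      (All-shift (λ (_ , a∈ws) → length≤ a∈ws) over) (ℕₚ.<-irrefl ≡.refl)

    coef-M-m : coef M m ≈ 0#
    coef-M-m = trans (coef-M m) (trans (+-congʳ (*-congˡ (+-congˡ (coef-S-top e))))
      (solve 1 (λ g → g :^ 2 :* (g :+ con 0̇) :+ :- g :^ 3 := con 0̇) refl g))

    -- M is a relation between cubes with coefficient zero at m, so the independence of the cubes
    -- over ws makes all its coefficients vanish.
    relation : ∀ a → g ^ 2 * (coef L a + coef S a) ≈ coef L a ^ 3
    relation a = begin
      u             ≈⟨ solve 2 (λ u v → u := (u :+ :- v) :+ v) refl u v ⟩
      (u + - v) + v ≈⟨ +-congʳ (trans (sym (coef-M a)) (independent-∷ ind³ M over-M coef-M-m eval-M a)) ⟩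
      0# + v        ≈⟨ +-identityˡ v ⟩
      v             ∎
      where
      u = g ^ 2 * (coef L a + coef S a)
      v = coef L a ^ 3

    -- S contributes nothing at this length, so the relation reduces to g² c = c³.
    sibling : ∀ e′ → coef L (e′ ∷ b) ≈ 0# ⊎ Deg≡ n (coef L (e′ ∷ b))
    sibling e′ = constant-root (poly-coef over _) deg-g
      (trans (*-congˡ (sym (trans (+-congˡ (coef-S-top e′)) (+-identityʳ _)))) (relation (e′ ∷ b)))

    3∣⇒0 : ∀ e′ → 3 ∣ e′ → coef L (e′ ∷ b) ≈ 0#
    3∣⇒0 e′ 3∣e′ = coef-absent good λ { (3∤e′ ∷ _) → 3∤e′ 3∣e′ }

    coef-S-b : ∃[ E ] 3 ∤ E × Deg≡ (n ℕ.+ E ℕ.* 4) (coef S b)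
    coef-S-b = from-bound (proj₂ (head-bound L))
      where
      from-bound : ∀ {B} → All (HeadBelow B ∘ proj₂) L → ∃[ E ] 3 ∤ E × Deg≡ (n ℕ.+ E ℕ.* 4) (coef S b)
      from-bound {B} below =
        let E , 3∤E , p = Deg≡-∑x sibling 3∣⇒0 e<B deg-g
        in E , 3∤E , Deg≡-resp (sym (coef-shift b L below)) p
        where
        e<B : e < B
        -- Otherwise m would not occur in L and g would be zero.
        e<B = decidable-stable (e ℕₚ.<? B) λ e≮B → Deg≡⇒≉0 deg-g (coef-absent {HeadBelow B} below e≮B)

    contradiction : ⊥
    contradiction = let E , 3∤E , deg-S = coef-S-b in refute 3∤E deg-S (0⊎Deg≡ (poly-coef over b))
      where
      refute : ∀ {E} → 3 ∤ E → Deg≡ (n ℕ.+ E ℕ.* 4) (coef S b) → ¬ (coef L b ≈ 0# ⊎ ∃[ k ] Deg≡ k (coef L b))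
      -- With c = coef L b and d = coef S b, `relation b` is the equation excluded by `no-root`.
      -- That lemma needs a degree for c, so c = 0 is treated apart: then g² d = 0, although both
      -- factors have a degree.
      refute 3∤E deg-S (inj₂ (k , deg-c)) = no-root 3∤E deg-g deg-c deg-S (relation b)
      refute 3∤E deg-S (inj₁ c≈0)         = Deg≡⇒≉0 (Deg≡-* (Deg≡-^ 2 deg-g) deg-S) (begin
        g ^ 2 * coef S b                ≈⟨ *-congˡ (trans (+-congʳ c≈0) (+-identityˡ _)) ⟨
        g ^ 2 * (coef L b + coef S b)   ≈⟨ relation b ⟩
        coef L b ^ 3                    ≈⟨ trans (^-congˡ 3 c≈0) (solve 0 (con 0̇ :^ 3 := con 0̇) refl) ⟩
        0#                              ∎)

  -- Replacing h(m)³ by h(m) - x ^ e h(b)³ and rewriting all other cubes over ws in terms of h gives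
  -- a relation between the h whose coefficient at m is still g; hence g = 0.
  independent-h³ : ∀ {e b ws} → Stair ((e ∷ b) ∷ ws) → Independent h ((e ∷ b) ∷ ws) → Independent h³ ws →
                   Independent h³ ((e ∷ b) ∷ ws)
  independent-h³ {e} {b} {ws} stair@(step 3∤e b∈ws _ s) ind ind³ M over evalM≈0 = go (member? _≟ᴸ_ m ws)
    where
    m = e ∷ b
    g = coef M m
    N = eval h³ (remove m M)

    go : Dec (m ∈ ws) → ∀ a → coef M a ≈ 0#
    -- A `Stair` may repeat a tuple; then m adds nothing to ws.
    go (yes m∈ws) = ind³ M (All.map (λ { (p , here ≡.refl) → p , m∈ws ; (p , there a∈ws) → p , a∈ws }) over) evalM≈0
    go (no m∉ws)  = independent-∷ ind³ M over g≈0 evalM≈0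
      where
      span : ∃[ L ] Over ws L × eval h L ≈ - (g * x ^ e) * h³ b + N
      span = cubes⊂span s
        ((poly-neg (poly-* (poly-coef over m) (poly-^ e poly-x)) , b∈ws) ∷ remove-over over)
      L     = proj₁ span
      overL = proj₁ (proj₂ span)

      vanish : eval h ((g , m) ∷ L) ≈ 0#
      vanish = begin
        g * h m + eval h L
          ≈⟨ +-cong (*-congˡ (h-∷ (stair-∤ stair (here ≡.refl)))) (proj₂ (proj₂ span)) ⟩
        g * (h³ m + x ^ e * h³ b) + (- (g * x ^ e) * h³ b + N)
          ≈⟨ solve 5 (λ g y p z r → g :* (y :+ p :* z) :+ (:- (g :* p) :* z :+ r) := g :* y :+ r) refl
               g (h³ m) (x ^ e) (h³ b) N ⟩
        g * h³ m + N                                                    ≈⟨ eval-remove h³ m M ⟨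
        eval h³ M                                                       ≈⟨ evalM≈0 ⟩
        0#                                                              ∎

      g≈0 : g ≈ 0#
      g≈0 = begin
        g                            ≈⟨ +-identityʳ g ⟨
        g + 0#                       ≈⟨ +-cong ([]-yes (m ≟ᴸ m) ≡.refl) (coef-absent {_∈ ws} (All.map proj₂ overL) m∉ws) ⟨
        [ m ≟ᴸ m ] g + coef L m
          ≈⟨ ind ((g , m) ∷ L) ((poly-coef over m , here ≡.refl) ∷ All.map (λ (p , a∈ws) → p , there a∈ws) overL) vanish m ⟩
        0#                           ∎

  eval-base : ∀ f → f [] ≈ 1# → (L : Combo) → Over ([] ∷ []) L → eval f L ≈ coef L []
  eval-base f f-[] [] [] = refl
  eval-base f f-[] ((c , [])    ∷ L) (_ ∷ over)              = +-cong (trans (*-congˡ f-[]) (*-identityʳ c)) (eval-base f f-[] L over)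
  eval-base f f-[] ((c , _ ∷ _) ∷ L) ((_ , here ()) ∷ _)
  eval-base f f-[] ((c , _ ∷ _) ∷ L) ((_ , there ()) ∷ _)

  independent-base : ∀ f → f [] ≈ 1# → Independent f ([] ∷ [])
  independent-base f f-[] L over eq []      = trans (sym (eval-base f f-[] L over)) eq
  independent-base f f-[] L over eq (e ∷ b) = coef-absent {_∈ [] ∷ []} (All.map proj₂ over) λ { (here ()) ; (there ()) }

  -- The two claims alternate: h over the longer list uses both claims for the shorter one, and the
  -- cubes over the longer list use h over the same list.
  independence : ∀ {ws} → Stair ws → Independent h ws × Independent h³ ws
  independence base = independent-base h h-[] , independent-base h³ (trans (^-congˡ 3 h-[]) (solve 0 (con 1̇ :^ 3 := con 1̇) refl))
  independence stair@(step _ _ _ s) with independence s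
  ... | ind , ind³ = ind′ , independent-h³ stair ind′ ind³
    where ind′ = independent-h stair ind ind³

-- Frobenius and the product Ψ, the summands and the nested sums

module Identities (R : Char3Ring) where
  open Char3Ring R
  open Char3 R
  open 𝔽₃-Solver
  open import Relation.Binary.Reasoning.Setoid setoid

  Unit : Carrier → Set
  Unit u = ∃[ i ] i * u ≈ 1#

  unit-cancelˡ : ∀ {u a b} → Unit u → u * a ≈ u * b → a ≈ b
  unit-cancelˡ {u} {a} {b} (i , iu≈1) ua≈ub = begin
    a             ≈⟨ restore a ⟨
    i * (u * a)   ≈⟨ *-congˡ ua≈ub ⟩
    i * (u * b)   ≈⟨ restore b ⟩
    b             ∎
    where
    restore : ∀ c → i * (u * c) ≈ c
    restore c = trans (sym (*-assoc i u c)) (trans (*-congʳ iu≈1) (*-identityˡ c))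

  unit-^ : ∀ {u} k → Unit u → Unit (u ^ k)
  unit-^ zero    _ = 1# , *-identityˡ 1#
  unit-^ {u} (suc k) (i , iu≈1) with unit-^ k (i , iu≈1)
  ... | j , ju≈1 = i * j , (begin
    i * j * (u * u ^ k)       ≈⟨ solve 4 (λ i j u v → i :* j :* (u :* v) := (i :* u) :* (j :* v)) refl i j u (u ^ k) ⟩
    (i * u) * (j * u ^ k)     ≈⟨ *-cong iu≈1 ju≈1 ⟩
    1# * 1#                   ≈⟨ *-identityˡ 1# ⟩
    1#                        ∎)

  frobenius-1+ : ∀ y → (1# + y) ^ 3 ≈ 1# + y ^ 3
  frobenius-1+ = solve 1 (λ y → (con 1̇ :+ y) :^ 3 := con 1̇ :+ y :^ 3) refl

  frobenius-^ : ∀ y k → (y ^ k) ^ 3 ≈ (y ^ 3) ^ k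
  frobenius-^ y zero    = solve 0 (con 1̇ :^ 3 := con 1̇) refl
  frobenius-^ y (suc k) = trans (frobenius-* y (y ^ k)) (*-congˡ (frobenius-^ y k))

  -- P N is the product of 1 + Z k for k < N. Cubing moves each factor to the next index, so P(N)³
  -- is P(N + 1) without its first factor.
  product-cube : ∀ (Z P : ℕ → Carrier) → (∀ k → Z (suc k) ≈ Z k ^ 3) → P 0 ≈ 1# →
                 (∀ N → P (suc N) ≈ P N * (1# + Z N)) → ∀ N → P (suc N) ≈ (1# + Z 0) * P N ^ 3
  product-cube Z P Z-suc P-0 P-suc zero    = begin
    P 1                        ≈⟨ P-suc 0 ⟩
    P 0 * (1# + Z 0)           ≈⟨ *-congʳ P-0 ⟩
    1# * (1# + Z 0)            ≈⟨ solve 1 (λ z → con 1̇ :* z := z :* con 1̇ :^ 3) refl (1# + Z 0) ⟩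
    (1# + Z 0) * 1# ^ 3        ≈⟨ *-congˡ (^-congˡ 3 P-0) ⟨
    (1# + Z 0) * P 0 ^ 3       ∎
  product-cube Z P Z-suc P-0 P-suc (suc N) = begin
    P (suc (suc N))                                ≈⟨ P-suc (suc N) ⟩
    P (suc N) * (1# + Z (suc N))
      ≈⟨ *-cong (product-cube Z P Z-suc P-0 P-suc N) (trans (+-congˡ (Z-suc N)) (sym (frobenius-1+ (Z N)))) ⟩
    (1# + Z 0) * P N ^ 3 * (1# + Z N) ^ 3          ≈⟨ *-assoc _ _ _ ⟩
    (1# + Z 0) * (P N ^ 3 * (1# + Z N) ^ 3)        ≈⟨ *-congˡ (trans (^-congˡ 3 (P-suc N)) (frobenius-* (P N) (1# + Z N))) ⟨
    (1# + Z 0) * P (suc N) ^ 3                     ∎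

  -- Cancels one factor u; for the infinite product this reads Ψ² = 1 / (1 + z).
  inverse-square : ∀ {z u} → Unit u → u ≈ (1# + z) * u ^ 3 → (1# + z) * u ^ 2 ≈ 1#
  inverse-square {z} {u} unit-u u≈ = unit-cancelˡ unit-u (begin
    u * ((1# + z) * u ^ 2)   ≈⟨ solve 2 (λ z u → u :* ((con 1̇ :+ z) :* u :^ 2) := (con 1̇ :+ z) :* u :^ 3) refl z u ⟩
    (1# + z) * u ^ 3         ≈⟨ u≈ ⟨
    u                        ≈⟨ *-identityʳ u ⟨
    u * 1#                   ∎)

  -- Since 1 + Z³ = (1 + Z)³, one factor 1 + Z cancels and s = Z / (1 + Z)².
  summand-square : ∀ {s Z} → Unit (1# + Z) → s * (1# + Z ^ 3) ≈ Z * (1# + Z) → s * (1# + Z) ^ 2 ≈ Z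
  summand-square {s} {Z} unit eq = unit-cancelˡ unit (begin
    (1# + Z) * (s * (1# + Z) ^ 2)
      ≈⟨ solve 2 (λ s Z → (con 1̇ :+ Z) :* (s :* (con 1̇ :+ Z) :^ 2) := s :* (con 1̇ :+ Z :^ 3)) refl s Z ⟩
    s * (1# + Z ^ 3)                ≈⟨ eq ⟩
    Z * (1# + Z)                    ≈⟨ *-comm Z (1# + Z) ⟩
    (1# + Z) * Z                    ∎)

  summand-cube : ∀ {s s′ Z Z′} → Unit (1# + Z′) → Z′ ≈ Z ^ 3 → s * (1# + Z) ^ 2 ≈ Z → s′ * (1# + Z′) ^ 2 ≈ Z′ →
                 s′ ≈ s ^ 3
  summand-cube {s} {s′} {Z} {Z′} unit Z′≈Z³ s-eq s′-eq = unit-cancelˡ (unit-^ 2 unit) (begin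
    (1# + Z′) ^ 2 * s′         ≈⟨ *-comm _ s′ ⟩
    s′ * (1# + Z′) ^ 2         ≈⟨ s′-eq ⟩
    Z′                         ≈⟨ Z′≈Z³ ⟩
    Z ^ 3                      ≈⟨ ^-congˡ 3 s-eq ⟨
    (s * (1# + Z) ^ 2) ^ 3     ≈⟨ solve 2 (λ s Z → (s :* (con 1̇ :+ Z) :^ 2) :^ 3 := (con 1̇ :+ Z :^ 3) :^ 2 :* s :^ 3) refl s Z ⟩
    (1# + Z ^ 3) ^ 2 * s ^ 3   ≈⟨ *-congʳ (^-congˡ 2 (+-congˡ Z′≈Z³)) ⟨
    (1# + Z′) ^ 2 * s ^ 3      ∎)

  -- Writing z = (1 + z) - 1 and 1 / (1 + z) = u² turns z / (1 + z)² into u² - u⁴.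
  summand-via-u : ∀ {s z u} → s * (1# + z) ^ 2 ≈ z → (1# + z) * u ^ 2 ≈ 1# → s ≈ u ^ 2 + - u ^ 4
  summand-via-u {s} {z} {u} s-eq u-eq = begin
    s                                       ≈⟨ solve 1 (λ s → s := s :* con 1̇ :^ 2) refl s ⟩
    s * 1# ^ 2                              ≈⟨ *-congˡ (^-congˡ 2 u-eq) ⟨
    s * ((1# + z) * u ^ 2) ^ 2
      ≈⟨ solve 3 (λ s z u → s :* ((con 1̇ :+ z) :* u :^ 2) :^ 2 := s :* (con 1̇ :+ z) :^ 2 :* u :^ 4) refl s z u ⟩
    s * (1# + z) ^ 2 * u ^ 4                ≈⟨ *-congʳ s-eq ⟩
    z * u ^ 4
      ≈⟨ solve 2 (λ z u → z :* u :^ 4 := (con 1̇ :+ z) :* u :^ 2 :* u :^ 2 :+ :- u :^ 4) refl z u ⟩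
    (1# + z) * u ^ 2 * u ^ 2 + - u ^ 4      ≈⟨ +-congʳ (trans (*-congʳ u-eq) (*-identityˡ _)) ⟩
    u ^ 2 + - u ^ 4                         ∎

  -- The expansion is -2t - 5t² - 4t³ - t⁴, which modulo 3 is t + t² + 2t³ + 2t⁴.
  Deg≡-u²-u⁴ : ∀ {t} (transcendental : Transcendental R t) →
               Degree.Deg≡ R t transcendental 4 ((1# + t) ^ 2 + - (1# + t) ^ 4)
  Deg≡-u²-u⁴ {t} transcendental = step 0̇ _
    (solve 1 (λ t → (con 1̇ :+ t) :^ 2 :+ :- (con 1̇ :+ t) :^ 4 :=
                    con 0̇ :+ t :* (con 1̇ :+ t :* (con 1̇ :+ t :* (con 2̇ :+ t :* con 2̇)))) refl t)
    (step 1̇ _ refl (step 1̇ _ refl (step 2̇ _ refl (const 2̇ (λ ()) refl))))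
    where open Degree R t transcendental

  -- G as K stands for the sum over K > k₁ > ... > kᵣ ≥ 0 of the products of the x kⱼ ^ aⱼ, given by
  -- recursion on the outermost index; `H̃-partial` is the instance.
  module NestedSums
    (x : ℕ → Carrier) (x-suc : ∀ k → x (suc k) ≈ x k ^ 3)
    (G : List ℕ → ℕ → Carrier) (G-[] : ∀ K → G [] K ≈ 1#) (G-0 : ∀ a as → G (a ∷ as) 0 ≈ 0#)
    (G-suc : ∀ a as K → G (a ∷ as) (suc K) ≈ G (a ∷ as) K + x K ^ a * G as K)
    where

    G-snoc-0 : ∀ as e → G (as ++ e ∷ []) 0 ≈ 0#
    G-snoc-0 []       e = G-0 e []
    G-snoc-0 (a ∷ as) e = G-0 a (as ++ e ∷ [])

    -- Splits off the innermost index: either it is 0 or every index is positive.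
    G-snoc : ∀ as e K → G (as ++ e ∷ []) (suc K) ≈ G (as ++ e ∷ []) K ^ 3 + x 0 ^ e * G as K ^ 3
    G-snoc [] e zero = begin
      G (e ∷ []) 1                                ≈⟨ G-suc e [] 0 ⟩
      G (e ∷ []) 0 + x 0 ^ e * G [] 0             ≈⟨ +-cong (G-0 e []) (*-congˡ (G-[] 0)) ⟩
      0# + x 0 ^ e * 1#
        ≈⟨ solve 1 (λ p → con 0̇ :+ p :* con 1̇ := con 0̇ :^ 3 :+ p :* con 1̇ :^ 3) refl (x 0 ^ e) ⟩
      0# ^ 3 + x 0 ^ e * 1# ^ 3                   ≈⟨ +-cong (^-congˡ 3 (G-0 e [])) (*-congˡ (^-congˡ 3 (G-[] 0))) ⟨
      G (e ∷ []) 0 ^ 3 + x 0 ^ e * G [] 0 ^ 3     ∎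
    G-snoc (a ∷ as) e zero = begin
      G (a ∷ as ++ e ∷ []) 1                                      ≈⟨ G-suc a (as ++ e ∷ []) 0 ⟩
      G (a ∷ as ++ e ∷ []) 0 + x 0 ^ a * G (as ++ e ∷ []) 0       ≈⟨ +-cong (G-snoc-0 (a ∷ as) e) (*-congˡ (G-snoc-0 as e)) ⟩
      0# + x 0 ^ a * 0#
        ≈⟨ solve 2 (λ p q → con 0̇ :+ p :* con 0̇ := con 0̇ :^ 3 :+ q :* con 0̇ :^ 3) refl (x 0 ^ a) (x 0 ^ e) ⟩
      0# ^ 3 + x 0 ^ e * 0# ^ 3
        ≈⟨ +-cong (^-congˡ 3 (G-snoc-0 (a ∷ as) e)) (*-congˡ (^-congˡ 3 (G-0 a as))) ⟨
      G (a ∷ as ++ e ∷ []) 0 ^ 3 + x 0 ^ e * G (a ∷ as) 0 ^ 3     ∎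
    G-snoc [] e (suc K) = begin
      G (e ∷ []) (suc (suc K))                                                          ≈⟨ G-suc e [] (suc K) ⟩
      G (e ∷ []) (suc K) + x (suc K) ^ e * G [] (suc K)
        ≈⟨ +-cong (G-snoc [] e K) (*-cong (trans (^-congˡ e (x-suc K)) (sym (frobenius-^ (x K) e))) (G-[] (suc K))) ⟩
      (G (e ∷ []) K ^ 3 + x 0 ^ e * G [] K ^ 3) + (x K ^ e) ^ 3 * 1#
        ≈⟨ +-cong (+-congˡ (*-congˡ (^-congˡ 3 (G-[] K)))) refl ⟩
      (G (e ∷ []) K ^ 3 + x 0 ^ e * 1# ^ 3) + (x K ^ e) ^ 3 * 1#
        ≈⟨ solve 3 (λ g p q → (g :^ 3 :+ p :* con 1̇ :^ 3) :+ q :^ 3 :* con 1̇ := (g :+ q :* con 1̇) :^ 3 :+ p :* con 1̇ :^ 3) refl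
             (G (e ∷ []) K) (x 0 ^ e) (x K ^ e) ⟩
      (G (e ∷ []) K + x K ^ e * 1#) ^ 3 + x 0 ^ e * 1# ^ 3
        ≈⟨ +-cong (^-congˡ 3 (trans (G-suc e [] K) (+-congˡ (*-congˡ (G-[] K))))) (*-congˡ (^-congˡ 3 (G-[] (suc K)))) ⟨
      G (e ∷ []) (suc K) ^ 3 + x 0 ^ e * G [] (suc K) ^ 3                               ∎
    -- The outermost index is peeled off; x (K + 1) ^ a = (x K ^ a)³ lets the solver gather both
    -- parts into cubes, which `G-suc` folds back.
    G-snoc (a ∷ as) e (suc K) = begin
      G (a ∷ as ++ e ∷ []) (suc (suc K))
        ≈⟨ G-suc a (as ++ e ∷ []) (suc K) ⟩
      G (a ∷ as ++ e ∷ []) (suc K) + x (suc K) ^ a * G (as ++ e ∷ []) (suc K)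
        ≈⟨ +-cong (G-snoc (a ∷ as) e K) (*-cong (trans (^-congˡ a (x-suc K)) (sym (frobenius-^ (x K) a))) (G-snoc as e K)) ⟩
      (G (a ∷ as ++ e ∷ []) K ^ 3 + x 0 ^ e * G (a ∷ as) K ^ 3) + (x K ^ a) ^ 3 * (G (as ++ e ∷ []) K ^ 3 + x 0 ^ e * G as K ^ 3)
        ≈⟨ solve 6 (λ g p f q g′ f′ → (g :^ 3 :+ p :* f :^ 3) :+ q :^ 3 :* (g′ :^ 3 :+ p :* f′ :^ 3) := (g :+ q :* g′) :^ 3 :+ p :* (f :+ q :* f′) :^ 3) refl
             (G (a ∷ as ++ e ∷ []) K) (x 0 ^ e) (G (a ∷ as) K) (x K ^ a) (G (as ++ e ∷ []) K) (G as K) ⟩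
      (G (a ∷ as ++ e ∷ []) K + x K ^ a * G (as ++ e ∷ []) K) ^ 3 + x 0 ^ e * (G (a ∷ as) K + x K ^ a * G as K) ^ 3
        ≈⟨ +-cong (^-congˡ 3 (G-suc a (as ++ e ∷ []) K)) (*-congˡ (^-congˡ 3 (G-suc a as K))) ⟨
      G (a ∷ as ++ e ∷ []) (suc K) ^ 3 + x 0 ^ e * G (a ∷ as) (suc K) ^ 3 ∎

-- Descent from 𝔽₃(u) to 𝔽₃(z)

layer : List ℕ → ℕ → List (List ℕ)
layer es zero    = [] ∷ []
layer es (suc r) = cartesianProductWith _∷_ es (layer es r)

-- Longer layers come first, so each tuple finds its tail further down the list, as `Stair` demands.
tower : List ℕ → ℕ → List (List ℕ)
tower es zero    = layer es zero
tower es (suc r) = layer es (suc r) ++ tower es r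

layer⊆tower : ∀ {es a} r → a ∈ layer es r → a ∈ tower es r
layer⊆tower zero    a∈ = a∈
layer⊆tower (suc r) a∈ = ∈-++⁺ˡ a∈

∈-layer : ∀ {es a} → All (_∈ es) a → a ∈ layer es (length a)
∈-layer []         = here ≡.refl
∈-layer (e∈ ∷ a⊆) = ∈-cartesianProductWith⁺ _∷_ e∈ (∈-layer a⊆)

∈-tower : ∀ {es a r} → length a ≤ r → All (_∈ es) a → a ∈ tower es r
∈-tower {es} {a} {r} len≤ a⊆ = climb r len≤
  where
  climb : ∀ r → length a ≤ r → a ∈ tower es r
  climb r len≤ with ℕₚ.m≤n⇒m<n∨m≡n len≤
  climb r       len≤ | inj₂ ≡.refl   = layer⊆tower r (∈-layer a⊆)
  climb (suc r) len≤ | inj₁ (s≤s lt) = ∈-++⁺ʳ (layer es (suc r)) (climb r lt)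

layer-length : ∀ {es} r → All (λ a → length a ≡ r) (layer es r)
layer-length zero    = ≡.refl ∷ []
layer-length {es} (suc r) = All.tabulate λ a∈ → length-∷ (∈-cartesianProductWith⁻ _∷_ es (layer es r) a∈)
  where
  length-∷ : ∀ {a} → ∃[ e ] ∃[ b ] e ∈ es × b ∈ layer es r × a ≡ e ∷ b → length a ≡ suc r
  length-∷ (e , b , _ , b∈ , ≡.refl) = ≡.cong suc (All.lookup (layer-length r) b∈)

tower-length : ∀ {es} r → All (λ a → length a ≤ r) (tower es r)
tower-length zero    = z≤n ∷ []
tower-length {es} (suc r) = Allₚ.++⁺ (All.map ℕₚ.≤-reflexive (layer-length {es} (suc r))) (All.map ℕₚ.m≤n⇒m≤1+n (tower-length r))

-- The order within a layer is free: the new tuples all have length r + 1, and their tails already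
-- lie in ws.
stair-++ : ∀ {ws r} xs → Stair ws → All (λ a → length a ≤ r) ws →
           All (λ a → ∃[ e ] ∃[ b ] a ≡ e ∷ b × 3 ∤ e × b ∈ ws × length b ≡ r) xs → Stair (xs ++ ws)
stair-++ []       s short []       = s
stair-++ (_ ∷ xs) s short ((e , b , ≡.refl , 3∤e , b∈ , ≡.refl) ∷ ps) =
  step 3∤e (∈-++⁺ʳ xs b∈)
    (Allₚ.++⁺ (All.map (λ { (_ , _ , ≡.refl , _ , _ , len) → ℕₚ.≤-reflexive (≡.cong suc len) }) ps)
              (All.map ℕₚ.m≤n⇒m≤1+n short))
    (stair-++ xs s short ps)

stair-tower : ∀ {es} → All (3 ∤_) es → ∀ r → Stair (tower es r)
stair-tower 3∤es zero    = base
stair-tower {es} 3∤es (suc r) = stair-++ (layer es (suc r)) (stair-tower 3∤es r) (tower-length r)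
  (All.tabulate λ a∈ → extend (∈-cartesianProductWith⁻ _∷_ es (layer es r) a∈))
  where
  extend : ∀ {a} → ∃[ e ] ∃[ b ] e ∈ es × b ∈ layer es r × a ≡ e ∷ b →
           ∃[ e ] ∃[ b ] a ≡ e ∷ b × 3 ∤ e × b ∈ tower es r × length b ≡ r
  extend (e , b , e∈ , b∈ , eq) =
    e , b , eq , All.lookup 3∤es e∈ , layer⊆tower r b∈ , All.lookup (layer-length r) b∈

length-bound : (as : List (List ℕ)) → ∃[ r ] All (λ a → length a ≤ r) as
length-bound []       = 0 , []
length-bound (a ∷ as) =
  let r , bounds = length-bound as
  in length a ℕ.⊔ r , ℕₚ.m≤m⊔n _ r ∷ All.map (λ len≤ → ℕₚ.m≤n⇒m≤o⊔n (length a) len≤) bounds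

-- Independence is known for stairs; finitely many tuples lie in the tower over their own entries,
-- up to their greatest length.
stair-cover : (as : List (List ℕ)) → All (All (3 ∤_)) as → ∃[ ws ] Stair ws × All (_∈ ws) as
stair-cover as 3∤as = tower es r , stair-tower 3∤es r ,
  All.tabulate λ {a} a∈ → ∈-tower (All.lookup bounds a∈)
    (All.tabulate λ e∈ → ∈-filter⁺ P? (∈-concat⁺′ e∈ a∈) (All.lookup (All.lookup 3∤as a∈) e∈))
  where
  P? : (e : ℕ) → Dec (3 ∤ e)
  P? e = ¬? (3 ∣? e)
  es = filter P? (concat as)
  r = proj₁ (length-bound as)
  bounds = proj₂ (length-bound as)
  3∤es : All (3 ∤_) es
  3∤es = All.tabulate λ e∈ → proj₂ (∈-filter⁻ P? {xs = concat as} e∈)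

-- The key (β, b) stands for h b, multiplied by u when β is `true`.
Key : Set
Key = Bool × List ℕ

_≟ᴷ_ : DecidableEquality Key
_≟ᴷ_ = ×-≡-dec Boolₚ._≟_ _≟ᴸ_

-- The model is u = Ψ; then x = z / (1 + z)².
record Uniformisation (R : Char3Ring) (t z u x : Char3Ring.Carrier R) : Set where
  open Char3Ring R
  field
    u≈1+t : u ≈ 1# + t
    u-eq  : (1# + z) * u ^ 2 ≈ 1#
    x-eq  : x ≈ u ^ 2 + - u ^ 4

module QuadraticExtension
  (R : Char3Ring)
  (t : Char3Ring.Carrier R) (transcendental-t : Transcendental R t)
  (z : Char3Ring.Carrier R) (transcendental-z : Transcendental R z)
  (u x : Char3Ring.Carrier R) (uniformisation : Uniformisation R t z u x)
  (h : List ℕ → Char3Ring.Carrier R) (h-tower : ArtinSchreierTower R x h)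
  where
  open Uniformisation uniformisation
  open Char3Ring R
  open Char3 R
  open 𝔽₃-Solver
  open Identities R
  open import Relation.Binary.Reasoning.Setoid setoid
  module T = Degree R t transcendental-t
  module Z = Degree R z transcendental-z
  open Combination R _≟ᴸ_
  module K = Combination R _≟ᴷ_

  deg-x : T.Deg≡ 4 x
  deg-x = T.Deg≡-resp (sym (trans x-eq (+-cong (^-congˡ 2 u≈1+t) (-‿cong (^-congˡ 4 u≈1+t))))) (Deg≡-u²-u⁴ transcendental-t)

  open ArtinSchreier R t transcendental-t x deg-x h h-tower using (Over; independence)

  poly-u : T.IsPoly u
  poly-u = T.poly-resp (sym u≈1+t) (T.poly-+ (T.poly-ι 1̇) T.poly-t)

  w : Carrier
  w = u ^ 2

  -- From (1 + z) w = 1 follows w z = 1 - w, so w ^ d absorbs up to d factors z and leaves a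
  -- polynomial in w, hence in t.
  clear-denominator : ∀ {n c} → Z.Deg< n c → ∀ d → n ≤ d → T.IsPoly (w ^ d * c)
  clear-denominator (Z.null c≈0) d _ = T.poly-resp (sym (trans (*-congˡ c≈0) (zeroʳ _))) (T.poly-ι 0̇)
  clear-denominator {c = c} (Z.step a c′ c≈ p) (suc d) (s≤s n≤d) = T.poly-resp (begin
    ι a * (w * w ^ d) + (1# + - w) * (w ^ d * c′)              ≈⟨ +-congˡ (*-congʳ (+-congʳ u-eq)) ⟨
    ι a * (w * w ^ d) + ((1# + z) * w + - w) * (w ^ d * c′)
      ≈⟨ solve 5 (λ a w W z c → a :* (w :* W) :+ ((con 1̇ :+ z) :* w :+ :- w) :* (W :* c) := w :* W :* (a :+ z :* c)) refl
           (ι a) w (w ^ d) z c′ ⟩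
    w ^ suc d * (ι a + z * c′)                                 ≈⟨ *-congˡ c≈ ⟨
    w ^ suc d * c                                              ∎)
    (T.poly-+ (T.poly-* (T.poly-ι a) (T.poly-^ (suc d) poly-w))
              (T.poly-* (T.poly-+ (T.poly-ι 1̇) (T.poly-neg poly-w)) (clear-denominator p d n≤d)))
    where
    poly-w : T.IsPoly w
    poly-w = T.poly-^ 2 poly-u

  -- P = − Q u would give (1 + z) P² = Q², whose sides have degrees of different parity.
  u-irrational : ∀ {P Q} → Z.IsPoly P → Z.IsPoly Q → P + Q * u ≈ 0# → P ≈ 0# × Q ≈ 0#
  u-irrational {P} {Q} poly-P poly-Q eq = go (Z.0⊎Deg≡ poly-P) (Z.0⊎Deg≡ poly-Q)
    where
    squares : (1# + z) * P ^ 2 ≈ Q ^ 2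
    squares = begin
      (1# + z) * P ^ 2
        ≈⟨ solve 4 (λ z P Q u → (con 1̇ :+ z) :* P :^ 2 := (con 1̇ :+ z) :* ((P :+ Q :* u) :* (P :+ :- (Q :* u))) :+ (con 1̇ :+ z) :* u :^ 2 :* Q :^ 2) refl
             z P Q u ⟩
      (1# + z) * ((P + Q * u) * (P + - (Q * u))) + (1# + z) * u ^ 2 * Q ^ 2     ≈⟨ +-cong (*-congˡ (*-congʳ eq)) (*-congʳ u-eq) ⟩
      (1# + z) * (0# * (P + - (Q * u))) + 1# * Q ^ 2
        ≈⟨ solve 3 (λ a b c → a :* (con 0̇ :* b) :+ con 1̇ :* c := c) refl (1# + z) (P + - (Q * u)) (Q ^ 2) ⟩
      Q ^ 2                                                   ∎

    deg-1+z : Z.Deg≡ 1 (1# + z)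
    deg-1+z = Z.step 1̇ 1# (+-congˡ (sym (*-identityʳ z))) (Z.const 1̇ (λ ()) refl)

    square-0 : ∀ {y} → y ≈ 0# → y ^ 2 ≈ 0#
    square-0 y≈0 = trans (^-congˡ 2 y≈0) (solve 0 (con 0̇ :^ 2 := con 0̇) refl)

    parity : ∀ {d e} → 1 ℕ.+ 2 ℕ.* d ≢ 2 ℕ.* e
    parity {d} {e} odd≡even = contradiction (∣1⇒≡1 (∣m+n∣m⇒∣n
      (≡.subst (2 ∣_) (≡.trans (≡.sym odd≡even) (ℕₚ.+-comm 1 (2 ℕ.* d))) (m∣m*n e)) (m∣m*n d)))
      where
      contradiction : 2 ≢ 1
      contradiction ()

    go : (P ≈ 0# ⊎ ∃[ d ] Z.Deg≡ d P) → (Q ≈ 0# ⊎ ∃[ e ] Z.Deg≡ e Q) → P ≈ 0# × Q ≈ 0#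
    go (inj₁ P≈0)       (inj₁ Q≈0)       = P≈0 , Q≈0
    go (inj₁ P≈0)       (inj₂ (e , deg)) = ⊥-elim (Z.Deg≡⇒≉0 (Z.Deg≡-^ 2 deg)
      (trans (sym squares) (trans (*-congˡ (square-0 P≈0)) (zeroʳ _))))
    go (inj₂ (d , deg)) (inj₁ Q≈0)       = ⊥-elim (Z.Deg≡⇒≉0 (Z.Deg≡-* deg-1+z (Z.Deg≡-^ 2 deg)) (trans squares (square-0 Q≈0)))
    go (inj₂ (d , deg)) (inj₂ (e , deg′)) = ⊥-elim (parity {d} {e} (Z.Deg≡-unique
      (Z.Deg≡-resp squares (Z.Deg≡-* deg-1+z (Z.Deg≡-^ 2 deg))) (Z.Deg≡-^ 2 deg′)))

  factor : Bool → Carrier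
  factor false = 1#
  factor true  = u

  value : Key → Carrier
  value (β , b) = factor β * h b

  -- The terms in h b and u h b come under the one tuple b by moving u into the coefficient; W will
  -- be a power of w that clears denominators.
  merge : Carrier → K.Combo → Combo
  merge W = List.map λ (c , β , b) → W * (c * factor β) , b

  eval-merge : ∀ W E → eval h (merge W E) ≈ W * K.eval value E
  eval-merge W [] = sym (zeroʳ W)
  eval-merge W ((c , β , b) ∷ E) = trans (+-congˡ (eval-merge W E))
    (solve 5 (λ W c φ y z → W :* (c :* φ) :* y :+ W :* z := W :* (c :* (φ :* y) :+ z)) refl W c (factor β) (h b) (K.eval value E))

  coef-merge : ∀ W E b → coef (merge W E) b ≈ W * (K.coef E (false , b) + K.coef E (true , b) * u)
  coef-merge W [] b = solve 2 (λ W u → con 0̇ := W :* (con 0̇ :+ con 0̇ :* u)) refl W u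
  coef-merge W ((c , β , b′) ∷ E) b = trans (+-cong (entry β (b′ ≟ᴸ b)) (coef-merge W E b))
    (solve 6 (λ W p q u r s → W :* (p :+ q :* u) :+ W :* (r :+ s :* u) := W :* ((p :+ r) :+ (q :+ s) :* u)) refl
      W _ _ u (K.coef E (false , b)) (K.coef E (true , b)))
    where
    entry : ∀ β (b′≟b : Dec (b′ ≡ b)) → [ b′≟b ] (W * (c * factor β)) ≈
            W * (K.[ (β , b′) ≟ᴷ (false , b) ] c + K.[ (β , b′) ≟ᴷ (true , b) ] c * u)
    entry false (yes ≡.refl) = sym (trans
      (*-congˡ (+-cong (K.[]-yes ((false , b) ≟ᴷ (false , b)) ≡.refl) (*-congʳ (K.[]-no ((false , b) ≟ᴷ (true , b)) {c} λ ()))))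
      (solve 3 (λ W c u → W :* (c :+ con 0̇ :* u) := W :* (c :* con 1̇)) refl W c u))
    entry true  (yes ≡.refl) = sym (trans
      (*-congˡ (+-cong (K.[]-no ((true , b) ≟ᴷ (false , b)) {c} λ ()) (*-congʳ (K.[]-yes ((true , b) ≟ᴷ (true , b)) ≡.refl))))
      (solve 3 (λ W c u → W :* (con 0̇ :+ c :* u) := W :* (c :* u)) refl W c u))
    entry β (no b′≢b) = sym (trans
      (*-congˡ (+-cong (K.[]-no ((β , b′) ≟ᴷ (false , b)) (b′≢b ∘ ≡.cong proj₂)) (*-congʳ (K.[]-no ((β , b′) ≟ᴷ (true , b)) (b′≢b ∘ ≡.cong proj₂)))))
      (solve 2 (λ W u → W :* (con 0̇ :+ con 0̇ :* u) := con 0̇) refl W u))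

  Admits : Carrier × Key → Set
  Admits (c , _ , b) = Z.IsPoly c × All (3 ∤_) b

  degree-bound : (E : K.Combo) → All Admits E → ∃[ d ] All (λ p → Z.Deg< d (proj₁ p)) E
  degree-bound []      []                        = 0 , []
  degree-bound (p ∷ E) (((n , deg) , _) ∷ admits) =
    let d , degs = degree-bound E admits
    in n ℕ.⊔ d , Z.Deg<-mono (ℕₚ.m≤m⊔n n d) deg ∷ All.map (Z.Deg<-mono (ℕₚ.m≤n⊔m n d)) degs

  -- After multiplication by w ^ d the coefficients are polynomials in t, over which the h are
  -- independent. This leaves P + Q u = 0 at each tuple, and `u-irrational` separates P from Q.
  independent-over-z : ∀ E → All Admits E → K.eval value E ≈ 0# → ∀ k → K.coef E k ≈ 0#
  independent-over-z E admits eq = λ { (false , b) → proj₁ (both b) ; (true , b) → proj₂ (both b) }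
    where
    d     = proj₁ (degree-bound E admits)
    W     = w ^ d
    L     = merge W E
    cover = stair-cover (List.map proj₂ L) (Allₚ.map⁺ (Allₚ.map⁺ (All.map proj₂ admits)))
    ws    = proj₁ cover

    poly-factor : ∀ β → T.IsPoly (factor β)
    poly-factor false = T.poly-ι 1̇
    poly-factor true  = poly-u

    poly-L : All (T.IsPoly ∘ proj₁) L
    poly-L = Allₚ.map⁺ (All.map (λ {(c , β , b)} deg → T.poly-resp (*-assoc W c (factor β))
      (T.poly-* (clear-denominator deg d ℕₚ.≤-refl) (poly-factor β))) (proj₂ (degree-bound E admits)))

    over : Over ws L
    over = All.zip (poly-L , Allₚ.map⁻ (proj₂ (proj₂ cover)))

    L≈0 : ∀ b → coef L b ≈ 0#
    L≈0 = proj₁ (independence (proj₁ (proj₂ cover))) L over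
      (trans (eval-merge W E) (trans (*-congˡ eq) (zeroʳ W)))

    sum≈0 : ∀ b → K.coef E (false , b) + K.coef E (true , b) * u ≈ 0#
    -- w ^ d cancels because w has the inverse 1 + z.
    sum≈0 b = unit-cancelˡ (unit-^ d (1# + z , u-eq)) (trans (sym (coef-merge W E b)) (trans (L≈0 b) (sym (zeroʳ W))))

    poly-coefᴷ : ∀ k → Z.IsPoly (K.coef E k)
    poly-coefᴷ = K.coef-closed {Z.IsPoly} (Z.poly-ι 0̇) Z.poly-+ (All.map (λ {(c , k)} → proj₁) admits)

    both : ∀ b → K.coef E (false , b) ≈ 0# × K.coef E (true , b) ≈ 0#
    both b = u-irrational (poly-coefᴷ (false , b)) (poly-coefᴷ (true , b)) (sum≈0 b)

-- Power series modulo 3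

open import Data.Integer.Base using (_+_; _*_; _-_; -_)
open import Data.Nat.Base using (_∸_)
open ≡ using (refl; cong; cong₂; sym; trans; subst; module ≡-Reasoning)

-- A record, because x and y cannot be inferred from the difference x - y.
infix 4 _≡₃_
record _≡₃_ (x y : ℤ) : Set where
  constructor con₃
  field
    mod : x ≡ y [mod 3 ]
open _≡₃_ public

≡₃-reflexive : ∀ {x y} → x ≡ y → x ≡₃ y
≡₃-reflexive {x} refl = con₃ (dividesℤ 0ℤ (ℤₚ.+-inverseʳ x))

≡₃-sym : ∀ {x y} → x ≡₃ y → y ≡₃ x
≡₃-sym {x} {y} (con₃ p) = con₃ (subst (+ 3 ∣ℤ_) (lem x y) (∣m⇒∣-m p))
  where
  lem : ∀ x y → - (x - y) ≡ y - x
  lem = solve-∀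

≡₃-trans : ∀ {x y z} → x ≡₃ y → y ≡₃ z → x ≡₃ z
≡₃-trans {x} {y} {z} (con₃ p) (con₃ q) = con₃ (subst (+ 3 ∣ℤ_) (lem x y z) (∣m∣n⇒∣m+n p q))
  where
  lem : ∀ x y z → (x - y) + (y - z) ≡ x - z
  lem = solve-∀

≡₃-+ : ∀ {x x′ y y′} → x ≡₃ x′ → y ≡₃ y′ → x + y ≡₃ x′ + y′
≡₃-+ {x} {x′} {y} {y′} (con₃ p) (con₃ q) = con₃ (subst (+ 3 ∣ℤ_) (lem x x′ y y′) (∣m∣n⇒∣m+n p q))
  where
  lem : ∀ x x′ y y′ → (x - x′) + (y - y′) ≡ (x + y) - (x′ + y′)
  lem = solve-∀

≡₃-* : ∀ {x x′ y y′} → x ≡₃ x′ → y ≡₃ y′ → x * y ≡₃ x′ * y′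
≡₃-* {x} {x′} {y} {y′} (con₃ p) (con₃ q) =
  con₃ (subst (+ 3 ∣ℤ_) (lem x x′ y y′) (∣m∣n⇒∣m+n (∣n⇒∣m*n x q) (∣m⇒∣m*n y′ p)))
  where
  lem : ∀ x x′ y y′ → x * (y - y′) + (x - x′) * y′ ≡ x * y - x′ * y′
  lem = solve-∀

≡₃-neg : ∀ {x y} → x ≡₃ y → - x ≡₃ - y
≡₃-neg {x} {y} (con₃ p) = con₃ (subst (+ 3 ∣ℤ_) (lem x y) (∣m⇒∣-m p))
  where
  lem : ∀ x y → - (x - y) ≡ - x - (- y)
  lem = solve-∀

infix 4 _≐_
_≐_ : Series → Series → Set
f ≐ g = ∀ n → f n ≡ g n

-- At n + 1 convolution unfolds definitionally to f 0 * g (suc n) + ((f ∘ suc) ⊛ g) n; the ring laws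
-- below rest on inductions along this recursion.
⊛-cong : ∀ {f f′ g g′} → f ≐ f′ → g ≐ g′ → f ⊛ g ≐ f′ ⊛ g′
⊛-cong p q zero    = cong₂ _+_ (cong₂ _*_ (p 0) (q 0)) refl
⊛-cong p q (suc n) = cong₂ _+_ (cong₂ _*_ (p 0) (q (suc n))) (⊛-cong (p ∘ suc) q n)

⊛-distribˡ : ∀ f g h → f ⊛ (g ⊕ h) ≐ (f ⊛ g) ⊕ (f ⊛ h)
⊛-distribˡ f g h zero    = lem (f 0) (g 0) (h 0)
  where
  lem : ∀ x y z → x * (y + z) + 0ℤ ≡ (x * y + 0ℤ) + (x * z + 0ℤ)
  lem = solve-∀
⊛-distribˡ f g h (suc n) = trans (cong (λ u → f 0 * (g (suc n) + h (suc n)) + u) (⊛-distribˡ (f ∘ suc) g h n))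
  (lem (f 0) (g (suc n)) (h (suc n)) (((f ∘ suc) ⊛ g) n) (((f ∘ suc) ⊛ h) n))
  where
  lem : ∀ x y z u v → x * (y + z) + (u + v) ≡ (x * y + u) + (x * z + v)
  lem = solve-∀

-- The same unfolding from the other end, splitting off the constant term of g; commutativity
-- compares the two.
⊛-suc : ∀ f g n → (f ⊛ g) (suc n) ≡ f (suc n) * g 0 + (f ⊛ (g ∘ suc)) n
⊛-suc f g zero    = lem (f 0) (f 1) (g 0) (g 1)
  where
  lem : ∀ x x′ y y′ → x * y′ + (x′ * y + 0ℤ) ≡ x′ * y + (x * y′ + 0ℤ)
  lem = solve-∀
⊛-suc f g (suc n) = trans (cong (λ u → f 0 * g (suc (suc n)) + u) (⊛-suc (f ∘ suc) g n))
  (lem (f 0 * g (suc (suc n))) (f (suc (suc n)) * g 0) (((f ∘ suc) ⊛ (g ∘ suc)) n))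
  where
  lem : ∀ x y z → x + (y + z) ≡ y + (x + z)
  lem = solve-∀

⊛-comm : ∀ f g → f ⊛ g ≐ g ⊛ f
⊛-comm f g zero    = cong (_+ 0ℤ) (ℤₚ.*-comm (f 0) (g 0))
⊛-comm f g (suc n) = trans (cong₂ _+_ (ℤₚ.*-comm (f 0) (g (suc n))) (⊛-comm (f ∘ suc) g n)) (sym (⊛-suc g f n))

⊛-scale : ∀ c f g n → ((λ i → c * f i) ⊛ g) n ≡ c * (f ⊛ g) n
⊛-scale c f g zero    = lem c (f 0) (g 0)
  where
  lem : ∀ c x y → c * x * y + 0ℤ ≡ c * (x * y + 0ℤ)
  lem = solve-∀
⊛-scale c f g (suc n) = trans (cong (λ u → c * f 0 * g (suc n) + u) (⊛-scale c (f ∘ suc) g n))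
  (lem c (f 0) (g (suc n)) (((f ∘ suc) ⊛ g) n))
  where
  lem : ∀ c x y z → c * x * y + c * z ≡ c * (x * y + z)
  lem = solve-∀

⊛-distribʳ : ∀ h f g → (f ⊕ g) ⊛ h ≐ (f ⊛ h) ⊕ (g ⊛ h)
⊛-distribʳ h f g n = begin
  ((f ⊕ g) ⊛ h) n               ≡⟨ ⊛-comm (f ⊕ g) h n ⟩
  (h ⊛ (f ⊕ g)) n               ≡⟨ ⊛-distribˡ h f g n ⟩
  (h ⊛ f) n + (h ⊛ g) n         ≡⟨ cong₂ _+_ (⊛-comm h f n) (⊛-comm h g n) ⟩
  (f ⊛ h) n + (g ⊛ h) n         ∎
  where open ≡-Reasoning

⊛-assoc : ∀ f g h → (f ⊛ g) ⊛ h ≐ f ⊛ (g ⊛ h)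
⊛-assoc f g h zero    = lem (f 0) (g 0) (h 0)
  where
  lem : ∀ x y z → (x * y + 0ℤ) * z + 0ℤ ≡ x * (y * z + 0ℤ) + 0ℤ
  lem = solve-∀
⊛-assoc f g h (suc n) = begin
  (f 0 * g 0 + 0ℤ) * h (suc n) + (((λ i → f 0 * g (suc i)) ⊕ ((f ∘ suc) ⊛ g)) ⊛ h) n
    ≡⟨ cong (λ u → (f 0 * g 0 + 0ℤ) * h (suc n) + u) (⊛-distribʳ h (λ i → f 0 * g (suc i)) ((f ∘ suc) ⊛ g) n) ⟩
  (f 0 * g 0 + 0ℤ) * h (suc n) + (((λ i → f 0 * g (suc i)) ⊛ h) n + (((f ∘ suc) ⊛ g) ⊛ h) n)
    ≡⟨ cong₂ (λ u v → (f 0 * g 0 + 0ℤ) * h (suc n) + (u + v)) (⊛-scale (f 0) (g ∘ suc) h n) (⊛-assoc (f ∘ suc) g h n) ⟩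
  (f 0 * g 0 + 0ℤ) * h (suc n) + (f 0 * ((g ∘ suc) ⊛ h) n + ((f ∘ suc) ⊛ (g ⊛ h)) n)
    ≡⟨ lem (f 0) (g 0) (h (suc n)) (((g ∘ suc) ⊛ h) n) (((f ∘ suc) ⊛ (g ⊛ h)) n) ⟩
  f 0 * (g 0 * h (suc n) + ((g ∘ suc) ⊛ h) n) + ((f ∘ suc) ⊛ (g ⊛ h)) n ∎
  where
  open ≡-Reasoning
  lem : ∀ x y z u v → (x * y + 0ℤ) * z + (x * u + v) ≡ x * (y * z + u) + v
  lem = solve-∀

⊛-identityˡ : ∀ f → 1ˢ ⊛ f ≐ f
⊛-identityˡ f n = trans (⊛-comm 1ˢ f n) (⊛-1ˢ f n)

-- Coefficient n of a product depends only on coefficients up to n, so identities between partial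
-- products or sums pass to the limits one coefficient at a time.
Agree : ℕ → Series → Series → Set
Agree n f g = ∀ i → i ≤ n → f i ≡₃ g i

⊛-agree : ∀ {n f f′ g g′} → Agree n f f′ → Agree n g g′ → Agree n (f ⊛ g) (f′ ⊛ g′)
⊛-agree p q zero    i≤n = ≡₃-+ (≡₃-* (p 0 i≤n) (q 0 i≤n)) (≡₃-reflexive refl)
⊛-agree p q (suc i) (s≤s i≤n) = ≡₃-+ (≡₃-* (p 0 z≤n) (q (suc i) (s≤s i≤n)))
  (⊛-agree (λ j j≤n → p (suc j) (s≤s j≤n)) (λ j j≤n → q j (ℕₚ.m≤n⇒m≤1+n j≤n)) i i≤n)

⊕-agree : ∀ {n f f′ g g′} → Agree n f f′ → Agree n g g′ → Agree n (f ⊕ g) (f′ ⊕ g′)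
⊕-agree p q i i≤n = ≡₃-+ (p i i≤n) (q i i≤n)

infix 4 _≈₃_
record _≈₃_ (f g : Series) : Set where
  constructor mod₃
  field
    at : ∀ n → f n ≡₃ g n
open _≈₃_ public

≐⇒≈₃ : ∀ {f g} → f ≐ g → f ≈₃ g
≐⇒≈₃ f≐g = mod₃ λ n → ≡₃-reflexive (f≐g n)

≈₃⇒agree : ∀ {n f g} → f ≈₃ g → Agree n f g
≈₃⇒agree f≈g i _ = at f≈g i

𝔽₃⟦z⟧ : CommutativeRing 0ℓ 0ℓ
𝔽₃⟦z⟧ = record
  { Carrier = Series
  ; _≈_     = _≈₃_
  ; _+_     = _⊕_
  ; _*_     = _⊛_
  ; -_      = λ f n → - f n
  ; 0#      = 0ˢ
  ; 1#      = 1ˢ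
  ; isCommutativeRing = record
    { isRing = record
      { +-isAbelianGroup = record
        { isGroup = record
          { isMonoid = record
            { isSemigroup = record
              { isMagma = record
                { isEquivalence = record
                  { refl  = ≐⇒≈₃ λ _ → refl
                  ; sym   = λ p → mod₃ λ n → ≡₃-sym (at p n)
                  ; trans = λ p q → mod₃ λ n → ≡₃-trans (at p n) (at q n)
                  }
                ; ∙-cong = λ p q → mod₃ λ n → ≡₃-+ (at p n) (at q n)
                }
              ; assoc = λ f g h → ≐⇒≈₃ λ n → ℤₚ.+-assoc (f n) (g n) (h n)
              }
            ; identity = (λ f → ≐⇒≈₃ λ n → ℤₚ.+-identityˡ (f n)) , λ f → ≐⇒≈₃ λ n → ℤₚ.+-identityʳ (f n)
            }
          ; inverse = (λ f → ≐⇒≈₃ λ n → ℤₚ.+-inverseˡ (f n)) , λ f → ≐⇒≈₃ λ n → ℤₚ.+-inverseʳ (f n)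
          ; ⁻¹-cong = λ p → mod₃ λ n → ≡₃-neg (at p n)
          }
        ; comm = λ f g → ≐⇒≈₃ λ n → ℤₚ.+-comm (f n) (g n)
        }
      ; *-cong     = λ p q → mod₃ λ n → ⊛-agree (≈₃⇒agree p) (≈₃⇒agree q) n ℕₚ.≤-refl
      ; *-assoc    = λ f g h → ≐⇒≈₃ (⊛-assoc f g h)
      ; *-identity = (λ f → ≐⇒≈₃ (⊛-identityˡ f)) , λ f → ≐⇒≈₃ (⊛-1ˢ f)
      ; distrib    = (λ f g h → ≐⇒≈₃ (⊛-distribˡ f g h)) , λ h f g → ≐⇒≈₃ (⊛-distribʳ h f g)
      }
    ; *-comm = λ f g → ≐⇒≈₃ (⊛-comm f g)
    }
  }

series-ring : Char3Ring
series-ring = record { ring = 𝔽₃⟦z⟧ ; 1+1+1≈0 = mod₃ λ { zero → con₃ (dividesℤ 1ℤ refl) ; (suc n) → ≡₃-reflexive refl } }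

module S = Char3Ring series-ring
open Identities series-ring

-- Ψ, the summands and the nested sums modulo 3

z^-+ : ∀ a b → z^ a ⊛ z^ b ≐ z^ (a ℕ.+ b)
z^-+ zero    b n       = ⊛-identityˡ (z^ b) n
z^-+ (suc a) b zero    = refl
z^-+ (suc a) b (suc n) = trans (ℤₚ.+-identityˡ _) (z^-+ a b n)

z³ : ℕ → Series
z³ k = z^ (3 ℕ.^ k)

z³-suc : ∀ k → z³ (suc k) ≈₃ z³ k S.^ 3
z³-suc k = S.sym (begin
  z³ k ⊛ (z³ k ⊛ (z³ k ⊛ 1ˢ))                        ≈⟨ S.*-congˡ {x = z³ k} (S.*-congˡ {x = z³ k} (S.*-identityʳ (z³ k))) ⟩
  z³ k ⊛ (z³ k ⊛ z³ k)                               ≈⟨ S.*-congˡ {x = z³ k} (≐⇒≈₃ (z^-+ m m)) ⟩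
  z³ k ⊛ z^ (m ℕ.+ m)                              ≈⟨ ≐⇒≈₃ (z^-+ m (m ℕ.+ m)) ⟩
  z^ (m ℕ.+ (m ℕ.+ m))                            ≈⟨ S.reflexive (cong (λ i → z^ (m ℕ.+ (m ℕ.+ i))) (ℕₚ.+-identityʳ m)) ⟨
  z³ (suc k)                                       ∎)
  where
  open import Relation.Binary.Reasoning.Setoid S.setoid
  m = 3 ℕ.^ k

unit-series : ∀ {f} → f 0 ≡ 1ℤ → Unit f
unit-series {f} f₀ = 1ˢ ⊘ f , ≐⇒≈₃ (⊘-⊛ 1ˢ f f₀)

1+z³-head : ∀ k → (1ˢ ⊕ z³ k) 0 ≡ 1ℤ
1+z³-head k = cong (λ c → 1ℤ + c) (z^-off (ℕₚ.m^n>0 3 k))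

limit-agree : ∀ {s : ℕ → Series} {f} n → (∀ i M → i < M → s M i ≡ f i) → Agree n (s (suc n)) f
limit-agree n limit i i≤n = ≡₃-reflexive (limit i (suc n) (s≤s i≤n))

agree-cube : ∀ {n f g} → Agree n f g → Agree n (f S.^ 3) (g S.^ 3)
agree-cube p = ⊛-agree p (⊛-agree p (⊛-agree p λ _ _ → ≡₃-reflexive refl))

Ψ-coefficient : ∀ n M → n < M → Ψ-partial M n ≡ Ψ n
Ψ-coefficient n = proj₂ (Ψ-limit n)

-- Coefficient n is read at stage n + 2, which `product-cube` expresses through the cube of stage n
-- + 1; that stage agrees with Ψ up to n.
Ψ-frobenius : Ψ ≈₃ (1ˢ ⊕ z^ 1) ⊛ Ψ S.^ 3
Ψ-frobenius = mod₃ λ n → ≡₃-trans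
  (≡₃-reflexive (sym (Ψ-coefficient n (suc (suc n)) (s≤s (ℕₚ.n≤1+n n)))))
  (≡₃-trans (at (product-cube z³ Ψ-partial z³-suc (S.refl {1ˢ}) (λ N → S.refl {Ψ-partial (suc N)}) (suc n)) n)
    (⊛-agree {f = 1ˢ ⊕ z^ 1} (λ _ _ → ≡₃-reflexive refl) (agree-cube (limit-agree n Ψ-coefficient)) n ℕₚ.≤-refl))

Ψ² : (1ˢ ⊕ z^ 1) ⊛ Ψ S.^ 2 ≈₃ 1ˢ
Ψ² = inverse-square {z^ 1} {Ψ} (unit-series refl) Ψ-frobenius

summand-eq : ∀ k → summand k ⊛ (1ˢ ⊕ z³ k) S.^ 2 ≈₃ z³ k
summand-eq k = summand-square {summand k} {z³ k} (unit-series (1+z³-head k)) (S.trans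
  (S.*-congˡ {x = summand k} (S.+-congˡ {x = 1ˢ} (S.sym (z³-suc k))))
  (≐⇒≈₃ (⊘-⊛ (z³ k ⊛ (1ˢ ⊕ z³ k)) (1ˢ ⊕ z³ (suc k)) (1+z³-head (suc k)))))

summand-suc : ∀ k → summand (suc k) ≈₃ summand k S.^ 3
summand-suc k = summand-cube {summand k} {summand (suc k)} {z³ k} {z³ (suc k)}
  (unit-series (1+z³-head (suc k))) (z³-suc k) (summand-eq k) (summand-eq (suc k))

^ˢ≈^ : ∀ f a → f ^ˢ a ≈₃ f S.^ a
^ˢ≈^ f zero    = S.refl
^ˢ≈^ f (suc a) = S.*-congˡ {x = f} (^ˢ≈^ f a)

sumOver-map : ∀ a as K kss →
  sumOver (term (a ∷ as)) (List.map (K Vec.∷_) kss) ≈₃ summand K S.^ a ⊛ sumOver (term as) kss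
sumOver-map a as K []         = S.sym (S.zeroʳ (summand K S.^ a))
sumOver-map a as K (ks ∷ kss) = S.trans
  (S.+-cong (S.*-congʳ {x = term as ks} (^ˢ≈^ (summand K) a)) (sumOver-map a as K kss))
  (S.sym (S.distribˡ (summand K S.^ a) (term as ks) (sumOver (term as) kss)))

H̃-partial-suc : ∀ a as K →
  H̃-partial (a ∷ as) (suc K) ≈₃ H̃-partial (a ∷ as) K ⊕ summand K S.^ a ⊛ H̃-partial as K
H̃-partial-suc a as K = S.trans
  (≐⇒≈₃ (sumOver-++ (term (a ∷ as)) (chains (suc (length as)) K) (List.map (K Vec.∷_) (chains (length as) K))))
  (S.+-congˡ {x = H̃-partial (a ∷ as) K} (sumOver-map a as K (chains (length as) K)))

open NestedSums summand summand-suc H̃-partial (λ K → S.+-identityʳ 1ˢ) (λ a as → S.refl) H̃-partial-suc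

H̃-coefficient : ∀ {as} → All (0 <_) as → ∀ n M → n < M → H̃-partial as M n ≡ H̃ as n
H̃-coefficient pos n = proj₂ (H̃-limit pos n)

-- The limit of `G-snoc`, taken as for Ψ: stage n + 2 on the left, stage n + 1 inside the cubes.
H̃-snoc : ∀ {as e} → All (0 <_) as → 0 < e →
         H̃ (as ++ e ∷ []) ≈₃ H̃ (as ++ e ∷ []) S.^ 3 ⊕ summand 0 S.^ e ⊛ H̃ as S.^ 3
H̃-snoc {as} {e} pos e>0 = mod₃ λ n → ≡₃-trans
  (≡₃-reflexive (sym (H̃-coefficient pos′ n (suc (suc n)) (s≤s (ℕₚ.n≤1+n n)))))
  (≡₃-trans (at (G-snoc as e (suc n)) n)
    (⊕-agree (agree-cube (limit-agree n (H̃-coefficient pos′)))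
             (⊛-agree {f = summand 0 S.^ e} (λ _ _ → ≡₃-reflexive refl) (agree-cube (limit-agree n (H̃-coefficient pos)))) n ℕₚ.≤-refl))
  where
  pos′ : All (0 <_) (as ++ e ∷ [])
  pos′ = Allₚ.++⁺ pos (e>0 ∷ [])

-- Reversal makes the innermost exponent the head, so that `H̃-snoc` becomes the recursion of an
-- `ArtinSchreierTower`.
H̃ʳ : List ℕ → Series
H̃ʳ b = H̃ (reverse b)

3∤⇒>0 : ∀ {a} → 3 ∤ a → 0 < a
3∤⇒>0 {zero}  3∤0 = ⊥-elim (3∤0 (3 ∣0))
3∤⇒>0 {suc a} _   = s≤s z≤n

H̃ʳ-[] : H̃ʳ [] ≈₃ 1ˢ
H̃ʳ-[] = S.+-identityʳ 1ˢ

all-reverse : ∀ {P : ℕ → Set} {as} → All P as → All P (reverse as)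
all-reverse {as = as} = All-resp-↭ (↭-sym (↭-reverse as))

H̃ʳ-∷ : ∀ {e b} → All (3 ∤_) (e ∷ b) → H̃ʳ (e ∷ b) ≈₃ H̃ʳ (e ∷ b) S.^ 3 ⊕ summand 0 S.^ e ⊛ H̃ʳ b S.^ 3
H̃ʳ-∷ {e} {b} (3∤e ∷ 3∤b) rewrite Listₚ.unfold-reverse e b =
  H̃-snoc (all-reverse (All.map 3∤⇒>0 3∤b)) (3∤⇒>0 3∤e)

-- Ψ = 1 + z + ..., so v has order one; it generates the same field as Ψ and is the element t in
-- which degrees are measured.
v : Series
v n = Ψ n - 1ˢ n

Ψ≈1+v : Ψ ≈₃ 1ˢ ⊕ v
Ψ≈1+v = ≐⇒≈₃ λ n → lem (Ψ n) (1ˢ n)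
  where
  lem : ∀ x y → x ≡ y + (x - y)
  lem = solve-∀

-- Transcendental series and reduction of coefficients

open Char3 series-ring using (ι)

ι-head-injective : ∀ c → ι c 0 ≡₃ 0ℤ → c ≡ 0̇
ι-head-injective 0̇ _        = refl
ι-head-injective 1̇ (con₃ p) = ⊥-elim (from-no (+ 3 ∣ℤ? 1ℤ) p)
ι-head-injective 2̇ (con₃ p) = ⊥-elim (from-no (+ 3 ∣ℤ? + 2) p)

ι-tail : ∀ c n → ι c (suc n) ≡ 0ℤ
ι-tail 0̇ n = refl
ι-tail 1̇ n = refl
ι-tail 2̇ n = refl

-- The constant coefficient of the relation is c alone. Dividing the rest by z leaves (t / z) r = 0,
-- where t / z has constant term 1 and is a unit.
order-one-transcendental : ∀ {t} → t 0 ≡ 0ℤ → t 1 ≡ 1ℤ → Transcendental series-ring t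
order-one-transcendental {t} t₀ t₁ c r eq = c≡0 , unit-cancelˡ {t ∘ suc} {r} {0ˢ} (unit-series t₁) (S.trans tail≈0 (S.sym (S.zeroʳ (t ∘ suc))))
  where
  c≡0 : c ≡ 0̇
  c≡0 = ι-head-injective c (≡₃-trans (≡₃-reflexive (sym (trans (cong (λ x → ι c 0 + (x * r 0 + 0ℤ)) t₀) (ℤₚ.+-identityʳ _)))) (at eq 0))

  tail≈0 : (t ∘ suc) ⊛ r ≈₃ 0ˢ
  tail≈0 = mod₃ λ n → ≡₃-trans
    (≡₃-reflexive (sym (trans (cong₂ (λ x y → x + (y * r (suc n) + ((t ∘ suc) ⊛ r) n)) (ι-tail c n) t₀)
                              (trans (ℤₚ.+-identityˡ _) (ℤₚ.+-identityˡ _)))))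
    (at eq (suc n))

residue : ∀ x → ∃[ c ] x ≡₃ ι c 0
residue x = go (x ℤ.% + 3) (n%ℕd<d x 3) (con₃ (dividesℤ (x ℤ./ + 3)
  (trans (cong (_- + (x ℤ.% + 3)) (a≡a%n+[a/n]*n x (+ 3))) (lem (+ (x ℤ.% + 3)) _))))
  where
  lem : ∀ r q → r + q - r ≡ q
  lem = solve-∀

  go : ∀ r → r < 3 → x ≡₃ + r → ∃[ c ] x ≡₃ ι c 0
  go 0 _ p = 0̇ , p
  go 1 _ p = 1̇ , p
  go 2 _ p = 2̇ , p
  go (suc (suc (suc r))) (s≤s (s≤s (s≤s ()))) _

coeff-∷ : ∀ x {c} p → x ≡₃ ι c 0 → coeff (x ∷ p) ≈₃ ι c ⊕ z^ 1 ⊛ coeff p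
coeff-∷ x {c} p x≡c = mod₃ λ
  { zero    → ≡₃-trans x≡c (≡₃-reflexive (sym (ℤₚ.+-identityʳ _)))
  ; (suc n) → ≡₃-reflexive (sym (trans (cong₂ _+_ (ι-tail c n) (trans (ℤₚ.+-identityˡ _) (⊛-identityˡ (coeff p) n)))
                                       (ℤₚ.+-identityˡ _)))
  }

-- Instantiation, and translation from labels to formal combinations

module _ (R : Char3Ring) where
  private module R = Char3Ring R
  open Combination R _≟ᴷ_

  coef-tabulate-absent : ∀ {n} (c : Fin n → R.Carrier) (κ : Fin n → Key) k → (∀ j → κ j ≢ k) →
                         coef (tabulate λ j → c j , κ j) k R.≈ R.0#
  coef-tabulate-absent {zero}  c κ k κ≢k = R.refl
  coef-tabulate-absent {suc n} c κ k κ≢k = R.trans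
    (R.+-cong ([]-no (κ Fin.zero ≟ᴷ k) (κ≢k Fin.zero)) (coef-tabulate-absent (c ∘ Fin.suc) (κ ∘ Fin.suc) k (κ≢k ∘ Fin.suc)))
    (R.+-identityˡ R.0#)

  coef-tabulate : ∀ {n} (c : Fin n → R.Carrier) (κ : Fin n → Key) → Injective _≡_ _≡_ κ →
                  ∀ j → coef (tabulate λ j → c j , κ j) (κ j) R.≈ c j
  coef-tabulate {suc n} c κ inj Fin.zero    = R.trans
    (R.+-cong ([]-yes (κ Fin.zero ≟ᴷ κ Fin.zero) refl)
              (coef-tabulate-absent (c ∘ Fin.suc) (κ ∘ Fin.suc) (κ Fin.zero) λ j eq → Finₚ.0≢1+n (sym (inj eq))))
    (R.+-identityʳ (c Fin.zero))
  coef-tabulate {suc n} c κ inj (Fin.suc j) = R.trans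
    (R.+-cong ([]-no (κ Fin.zero ≟ᴷ κ (Fin.suc j)) λ eq → Finₚ.0≢1+n (inj eq))
              (coef-tabulate (c ∘ Fin.suc) (κ ∘ Fin.suc) (Finₚ.suc-injective ∘ inj) j))
    (R.+-identityˡ (c (Fin.suc j)))

v-transcendental : Transcendental series-ring v
v-transcendental = order-one-transcendental {v} refl refl

z-transcendental : Transcendental series-ring (z^ 1)
z-transcendental = order-one-transcendental {z^ 1} refl refl

Ψ-uniformisation : Uniformisation series-ring v (z^ 1) Ψ (summand 0)
Ψ-uniformisation = record
  { u≈1+t = Ψ≈1+v
  ; u-eq  = Ψ²
  ; x-eq  = summand-via-u {summand 0} {z^ 1} {Ψ} (summand-eq 0) Ψ²
  }

H̃ʳ-tower : ArtinSchreierTower series-ring (summand 0) H̃ʳ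
H̃ʳ-tower = record { h-[] = H̃ʳ-[] ; h-∷ = H̃ʳ-∷ }

open QuadraticExtension series-ring v v-transcendental (z^ 1) z-transcendental
  Ψ (summand 0) Ψ-uniformisation H̃ʳ H̃ʳ-tower

-- The series 1 is identified with the empty tuple, since `H̃ʳ []` is 1.
key : Label → Key
key one      = false , []
key H̃[ a ]  = false , reverse a
key ΨH̃[ a ] = true , reverse a

reverse≢[] : ∀ {a : List ℕ} → AdmissibleTuple a → [] ≢ reverse a
reverse≢[] {a} (1≤len , _) eq = ℕₚ.<⇒≢ 1≤len (trans (cong List.length eq) (Listₚ.length-reverse a))

-- Admissible tuples are nonempty, so none of them shares the key of `one`.
key-injective : ∀ {ℓ ℓ′} → Admissible ℓ → Admissible ℓ′ → key ℓ ≡ key ℓ′ → ℓ ≡ ℓ′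
key-injective {one}      {one}       _ _  eq = refl
key-injective {one}      {H̃[ a ]}   _ ad eq = ⊥-elim (reverse≢[] ad (cong proj₂ eq))
key-injective {H̃[ a ]}  {one}       ad _ eq = ⊥-elim (reverse≢[] ad (sym (cong proj₂ eq)))
key-injective {H̃[ a ]}  {H̃[ b ]}   _ _  eq = cong H̃[_] (Listₚ.reverse-injective (cong proj₂ eq))
key-injective {ΨH̃[ a ]} {ΨH̃[ b ]}  _ _  eq = cong ΨH̃[_] (Listₚ.reverse-injective (cong proj₂ eq))

key-∤ : ∀ ℓ → Admissible ℓ → All (3 ∤_) (proj₂ (key ℓ))
key-∤ one      _         = []
key-∤ H̃[ a ]  (_ , pos) = all-reverse (All.map proj₂ pos)
key-∤ ΨH̃[ a ] (_ , pos) = all-reverse (All.map proj₂ pos)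

value-key : ∀ ℓ → value (key ℓ) ≈₃ series ℓ
value-key one      = S.trans (S.*-identityˡ (H̃ʳ [])) H̃ʳ-[]
value-key H̃[ a ]  = S.trans (S.*-identityˡ (H̃ʳ (reverse a))) (S.reflexive (cong H̃ (Listₚ.reverse-involutive a)))
value-key ΨH̃[ a ] = S.reflexive (cong (λ b → Ψ ⊛ H̃ b) (Listₚ.reverse-involutive a))

poly-coeff : ∀ p → Z.IsPoly (coeff p)
poly-coeff []      = 0 , Z.null (≐⇒≈₃ λ _ → refl)
poly-coeff (x ∷ p) =
  let c , x≡c = residue x
      n , deg = poly-coeff p
  in suc n , Z.step c (coeff p) (coeff-∷ x {c} p x≡c) deg

eval-tabulate : ∀ {n} (f : Fin n → Series) (κ : Fin n → Key) N →
                K.eval value (tabulate λ j → f j , κ j) N ≡ ∑< n (λ j → (f j ⊛ value (κ j)) N)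
eval-tabulate {zero}  f κ N = refl
eval-tabulate {suc n} f κ N = cong (λ y → (f Fin.zero ⊛ value (κ Fin.zero)) N + y) (eval-tabulate (f ∘ Fin.suc) (κ ∘ Fin.suc) N)

∑-≡₃ : ∀ {n} (f g : Fin n → ℤ) → (∀ j → f j ≡₃ g j) → ∑< n f ≡₃ ∑< n g
∑-≡₃ {zero}  f g f≡g = ≡₃-reflexive refl
∑-≡₃ {suc n} f g f≡g = ≡₃-+ (f≡g Fin.zero) (∑-≡₃ (f ∘ Fin.suc) (g ∘ Fin.suc) (f≡g ∘ Fin.suc))

-- The keys are pairwise distinct, so the total coefficient at `κ j` is the single polynomial `p j`.
independent-mod-3 : LinearlyIndependentOn (λ x y → x ≡ y [mod 3 ]) Admissible series
independent-mod-3 n ι ι-injective admissible p ∑≡0 j N = mod (at (S.trans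
  (S.sym (coef-tabulate series-ring f κ κ-injective j)) (independent-over-z E admits E≈0 (κ j))) N)
  where
  f = coeff ∘ p
  κ = key ∘ ι
  E = tabulate λ j → f j , κ j

  κ-injective : Injective _≡_ _≡_ κ
  κ-injective {i} {j} eq = ι-injective (key-injective (admissible i) (admissible j) eq)

  admits : All Admits E
  admits = Allₚ.tabulate⁺ λ j → poly-coeff (p j) , key-∤ (ι j) (admissible j)

  E≈0 : K.eval value E ≈₃ 0ˢ
  E≈0 = mod₃ λ N → ≡₃-trans (≡₃-reflexive (eval-tabulate f κ N))
    (≡₃-trans (∑-≡₃ _ _ λ j → at (S.*-congˡ {x = f j} (value-key (ι j))) N) (con₃ (∑≡0 N)))

-- Moduli 3 ^ γ and 0

-- An equation of types, so that one rewriting serves both multiplication and division by 3.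
tripled : ∀ m x → (+ (3 ℕ.* m) ∣ℤ (+ 3 * x - 0ℤ)) ≡ (+ 3 * + m ∣ℤ + 3 * (x - 0ℤ))
tripled m x = cong₂ _∣ℤ_ (ℤₚ.pos-* 3 m) (lem x)
  where
  lem : ∀ x → + 3 * x - 0ℤ ≡ + 3 * (x - 0ℤ)
  lem = solve-∀

mod-triple : ∀ m x → x ≡ 0ℤ [mod m ] → (+ 3 * x) ≡ 0ℤ [mod 3 ℕ.* m ]
mod-triple m x p = subst (λ A → A) (sym (tripled m x)) (*-monoʳ-∣ (+ 3) p)

mod-third : ∀ m x → (+ 3 * x) ≡ 0ℤ [mod 3 ℕ.* m ] → x ≡ 0ℤ [mod m ]
mod-third m x p = *-cancelˡ-∣ (+ 3) (subst (λ A → A) (tripled m x) p)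

mod-3 : ∀ m x → x ≡ 0ℤ [mod 3 ℕ.* m ] → x ≡ 0ℤ [mod 3 ]
mod-3 m x = ∣-trans (dividesℤ (+ m) (trans (ℤₚ.pos-* 3 m) (ℤₚ.*-comm (+ 3) (+ m))))

third : ∀ p → (∀ N → coeff p N ≡ 0ℤ [mod 3 ]) → ∃[ q ] coeff p ≐ λ N → + 3 * coeff q N
third []      3∣p = [] , λ _ → refl
third (x ∷ p) 3∣p with third p (3∣p ∘ suc) | 3∣p 0
... | q , p≐3q | dividesℤ y x≡3y = y ∷ q , λ
  { zero    → trans (sym (ℤₚ.+-identityʳ x)) (trans x≡3y (ℤₚ.*-comm y (+ 3)))
  ; (suc N) → p≐3q N }

∑-scale : ∀ {n} c (f : Fin n → ℤ) → ∑< n (λ j → c * f j) ≡ c * ∑< n f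
∑-scale {zero}  c f = sym (ℤₚ.*-zeroʳ c)
∑-scale {suc n} c f = trans (cong (λ y → c * f Fin.zero + y) (∑-scale c (f ∘ Fin.suc))) (sym (ℤₚ.*-distribˡ-+ c _ _))

-- A relation modulo 3 ^ (γ + 1) has coefficients divisible by 3; divided by 3, it holds modulo 3 ^ γ.
independent-mod-3^ : ∀ {I : Set} (P : I → Set) (s : I → Series) →
  LinearlyIndependentOn (λ x y → x ≡ y [mod 3 ]) P s →
  ∀ γ → LinearlyIndependentOn (λ x y → x ≡ y [mod 3 ℕ.^ γ ]) P s
-- Modulo 3 ^ 0 = 1 all integers are congruent.
independent-mod-3^ P s ind zero    n ι inj Pι p ∑≡0 j N = dividesℤ (coeff (p j) N - 0ℤ) (sym (ℤₚ.*-identityʳ _))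
independent-mod-3^ P s ind (suc γ) n ι inj Pι p ∑≡0 j N =
  subst (λ x → x ≡ 0ℤ [mod 3 ℕ.^ suc γ ]) (sym (p≐3q j N))
    (mod-triple (3 ℕ.^ γ) (coeff (q j) N) (independent-mod-3^ P s ind γ n ι inj Pι q ∑q≡0 j N))
  where
  sum : (Fin n → Poly) → Series
  sum r N = ∑< n λ j → (coeff (r j) ⊛ s (ι j)) N

  3∣p : ∀ j N → coeff (p j) N ≡ 0ℤ [mod 3 ]
  3∣p = ind n ι inj Pι p λ N → mod-3 (3 ℕ.^ γ) (sum p N) (∑≡0 N)

  q : Fin n → Poly
  q j = proj₁ (third (p j) (3∣p j))

  p≐3q : ∀ j → coeff (p j) ≐ λ N → + 3 * coeff (q j) N
  p≐3q j = proj₂ (third (p j) (3∣p j))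

  ∑p≡3∑q : ∀ N → sum p N ≡ + 3 * sum q N
  ∑p≡3∑q N = trans
    (∑-cong _ _ λ j → trans (⊛-cong {g = s (ι j)} (p≐3q j) (λ _ → refl) N) (⊛-scale (+ 3) (coeff (q j)) (s (ι j)) N))
    (∑-scale (+ 3) (λ j → (coeff (q j) ⊛ s (ι j)) N))

  ∑q≡0 : ∀ N → sum q N ≡ 0ℤ [mod 3 ℕ.^ γ ]
  ∑q≡0 N = mod-third (3 ℕ.^ γ) (sum q N) (subst (λ x → x ≡ 0ℤ [mod 3 ℕ.^ suc γ ]) (∑p≡3∑q N) (∑≡0 N))

-- For x ≠ 0 the power 3 ^ |x| exceeds |x| and cannot divide it.
mod-all-3^⇒≡0 : ∀ x → (∀ γ → x ≡ 0ℤ [mod 3 ℕ.^ γ ]) → x ≡ 0ℤ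
mod-all-3^⇒≡0 x 3^∣x = ℤₚ.∣i∣≡0⇒i≡0 (small ℤ.∣ x ∣ refl)
  where
  small : ∀ m → ℤ.∣ x ∣ ≡ m → m ≡ 0
  small zero    _  = refl
  small (suc m) eq = ⊥-elim (>⇒∤ (n<3^n (suc m))
    (subst (3 ℕ.^ suc m ∣_) (trans (cong ℤ.∣_∣ (ℤₚ.+-identityʳ x)) eq) (∣⇒∣ᵤ (3^∣x (suc m)))))

independent-over-ℤ : ∀ {I : Set} (P : I → Set) (s : I → Series) →
  (∀ γ → LinearlyIndependentOn (λ x y → x ≡ y [mod 3 ℕ.^ γ ]) P s) → LinearlyIndependentOn _≡_ P s
independent-over-ℤ P s ind n ι inj Pι p ∑≡0 j N = mod-all-3^⇒≡0 (coeff (p j) N) λ γ →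
  ind γ n ι inj Pι p (λ N → dividesℤ 0ℤ (trans (ℤₚ.+-identityʳ _) (∑≡0 N))) j N

open import Data.Nat.Base using (_^_)

theorem2p6 : LinearlyIndependentOn (λ x y → x ≡ y [mod 3 ]) Admissible series
    × (∀ (γ : ℕ) → 1 ≤ γ → LinearlyIndependentOn (λ x y → x ≡ y [mod 3 ^ γ ]) Admissible series)
    × LinearlyIndependentOn _≡_ Admissible series
theorem2p6 = independent-mod-3 , (λ γ _ → independent-mod-3^ Admissible series independent-mod-3 γ)
           , independent-over-ℤ Admissible series (independent-mod-3^ Admissible series independent-mod-3)
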